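{- For every sequence $\mathbf{x}=\{x_k\}_{k\geq 1}$ of points in the unit circle $\mathbb{T}=\mathbb{R}/\mathbb{Z}$, the inequality $D_n(\mathbf{x})\geq \phi_n$ holds for infinitely many integers $n\geq 1$, where $D_n(\mathbf{x})=\max_{t\in\mathbb{T}}\big(\min_{1\leq k\leq n}\rho(t,x_k)\big)$ and $\phi_n=\frac{\ln(n+1)-\ln n}{2\ln 2}$.
   Context: $\mathbb{T}=\mathbb{R}/\mathbb{Z}$ is the unit circle with its standard metric $\rho(s,t)=\mathrm{dist}(s-t,\mathbb{Z})$, i.e. the distance from (any real representative of) $s-t$ to the nearest integer. Sequences are indexed by the integers $k\geq 1$; the terms of the sequence are not assumed to be distinct. -}

module Defs where

open import Data.Integer as ℤ using (ℤ; +_; 0ℤ)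
import Data.Integer.DivMod as ℤ
import Data.Integer.Properties as ℤ
open import Data.Nat as ℕ using (ℕ; zero; suc; NonZero)
import Data.Nat.Properties as ℕ
open import Data.Product using (∃-syntax; _×_; _,_)
open import Data.Bool using (true; false)
open import Data.Rational as ℚ using (ℚ; 0ℚ; 1ℚ; ½; mkℚ)
import Data.Rational.Properties as ℚ
open import Data.Rational.Solver using (module +-*-Solver)
import Data.Rational.Unnormalised as ℚᵘ
import Data.Rational.Unnormalised.Properties as ℚᵘ
open import Data.Sum using (inj₁; inj₂; [_,_]′)
open import Level using (0ℓ)
open import Relation.Binary.Bundles using (Setoid)
open import Relation.Binary.PropositionalEquality
  using (_≡_; _≢_; refl; sym; trans; cong; cong₂; subst; subst₂)
open import Relation.Nullary using (yes; no; contradiction)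

module _ where
  open import Data.Rational
  open +-*-Solver

  near⇒< : ∀ a b {ε} → ∣ a - b ∣ < ε → a < b + ε
  near⇒< a b {ε} h = begin-strict
    a              ≡⟨ solve 2 (λ a b → a := b :+ (a :- b)) refl a b ⟩
    b + (a - b)    ≤⟨ ℚ.+-monoʳ-≤ b (p≤∣p∣ (a - b)) ⟩
    b + ∣ a - b ∣  <⟨ ℚ.+-monoʳ-< b h ⟩
    b + ε          ∎
    where
    open ℚ.≤-Reasoning
    p≤∣p∣ : ∀ p → p ≤ ∣ p ∣
    p≤∣p∣ p with ℚ.≤-total 0ℚ p
    ... | inj₁ 0≤p = ℚ.≤-reflexive (sym (ℚ.0≤p⇒∣p∣≡p 0≤p))
    ... | inj₂ p≤0 = ℚ.≤-trans p≤0 (ℚ.0≤∣p∣ p)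

  ∣-∣-sym : ∀ a b → ∣ a - b ∣ ≡ ∣ b - a ∣
  ∣-∣-sym a b = trans (sym (ℚ.∣-p∣≡∣p∣ (a - b)))
    (cong ∣_∣ (solve 2 (λ a b → :- (a :- b) := b :- a) refl a b))

  near⇒> : ∀ a b {ε} → ∣ a - b ∣ < ε → b < a + ε
  near⇒> a b {ε} h = near⇒< b a (subst (_< ε) (∣-∣-sym a b) h)

  <⇒near : ∀ a b {ε} → a < b + ε → b < a + ε → ∣ a - b ∣ < ε
  <⇒near a b {ε} h k = [ (λ e → subst (_< ε) (sym e) (shift a b h))
                           , (λ e → subst (_< ε) (sym (trans e (flip a b))) (shift b a k)) ]′
                           (ℚ.∣p∣≡p∨∣p∣≡-p (a - b))
    where
    flip : ∀ a b → - (a - b) ≡ b - a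
    flip = solve 2 (λ a b → :- (a :- b) := b :- a) refl
    shift : ∀ a b → a < b + ε → a - b < ε
    shift a b h = subst (a - b <_) (solve 2 (λ b ε → (b :+ ε) :- b := ε) refl b ε)
                        (ℚ.+-monoˡ-< (- b) h)

  ∣-∣-triangle : ∀ a b c → ∣ a - c ∣ ≤ ∣ a - b ∣ + ∣ b - c ∣
  ∣-∣-triangle a b c = subst (λ u → ∣ u ∣ ≤ ∣ a - b ∣ + ∣ b - c ∣)
    (solve 3 (λ a b c → (a :- b) :+ (b :- c) := a :- c) refl a b c)
    (ℚ.∣p+q∣≤∣p∣+∣q∣ (a - b) (b - c))

  half-pos : ∀ {ε} → 0ℚ < ε → 0ℚ < ½ * ε
  half-pos {ε} h = ℚ.positive⁻¹ (½ * ε) {{ℚ.pos*pos⇒pos ½ ε {{positive h}}}}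

  half+half : ∀ ε → ½ * ε + ½ * ε ≡ ε
  half+half = solve 1 (λ ε → con ½ :* ε :+ con ½ :* ε := ε) refl

  half-sum : ∀ {a b} ε → a < ½ * ε → b < ½ * ε → a + b < ε
  half-sum {a} {b} ε h k = subst (a + b <_) (half+half ε) (ℚ.+-mono-< h k)

  *-pos : ∀ {a b} → 0ℚ < a → 0ℚ < b → 0ℚ < a * b
  *-pos {a} {b} h k = ℚ.positive⁻¹ (a * b) {{ℚ.pos*pos⇒pos a {{positive h}} b {{positive k}}}}

  recip : (a : ℚ) → .(0ℚ < a) → ℚ
  recip a h = 1/_ a {{>-nonZero h}}

  recip-pos : ∀ {a} (h : 0ℚ < a) → 0ℚ < recip a h
  recip-pos {a} h = ℚ.positive⁻¹ (recip a h) {{ℚ.1/pos⇒pos a {{positive h}}}}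

  recip-inv : ∀ {a} (h : 0ℚ < a) → a * recip a h ≡ 1ℚ
  recip-inv {a} h = ℚ.*-inverseʳ a {{>-nonZero h}}

  recip-Lipschitz : ∀ δ a b {ε} (0<δ : 0ℚ < δ) (δ≤a : δ ≤ a) (δ≤b : δ ≤ b)
                    (0<a : 0ℚ < a) (0<b : 0ℚ < b) → 0ℚ < ε →
                    ∣ a - b ∣ < ε * (δ * δ) → ∣ recip a 0<a - recip b 0<b ∣ < ε
  recip-Lipschitz δ a b {ε} 0<δ δ≤a δ≤b 0<a 0<b 0<ε h = begin-strict
    ∣ a′ - b′ ∣                        ≡⟨ cong ∣_∣ diff ⟩
    ∣ (b - a) * (a′ * b′) ∣            ≡⟨ ℚ.∣p*q∣≡∣p∣*∣q∣ (b - a) (a′ * b′) ⟩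
    ∣ b - a ∣ * ∣ a′ * b′ ∣            ≡⟨ cong₂ _*_ (∣-∣-sym b a) (ℚ.0≤p⇒∣p∣≡p (ℚ.<⇒≤ 0<a′b′)) ⟩
    ∣ a - b ∣ * (a′ * b′)              <⟨ ℚ.*-monoˡ-<-pos (a′ * b′) {{positive 0<a′b′}} h ⟩
    ε * (δ * δ) * (a′ * b′)            ≡⟨ solve 4 (λ ε δ a b → ε :* (δ :* δ) :* (a :* b) := ε :* (δ :* a) :* (δ :* b)) refl ε δ a′ b′ ⟩
    ε * (δ * a′) * (δ * b′)            ≤⟨ ℚ.*-monoˡ-≤-nonNeg (ε * (δ * a′)) {{nonNegative (ℚ.<⇒≤ (*-pos 0<ε (*-pos 0<δ (recip-pos 0<a))))}} (δ*recip≤1 0<b δ≤b) ⟩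
    ε * (δ * a′) * 1ℚ                  ≡⟨ ℚ.*-identityʳ _ ⟩
    ε * (δ * a′)                       ≤⟨ ℚ.*-monoˡ-≤-nonNeg ε {{nonNegative (ℚ.<⇒≤ 0<ε)}} (δ*recip≤1 0<a δ≤a) ⟩
    ε * 1ℚ                             ≡⟨ ℚ.*-identityʳ ε ⟩
    ε                                  ∎
    where
    open ℚ.≤-Reasoning
    a′ b′ : ℚ
    a′ = recip a 0<a
    b′ = recip b 0<b
    0<a′b′ : 0ℚ < a′ * b′
    0<a′b′ = *-pos (recip-pos 0<a) (recip-pos 0<b)
    δ*recip≤1 : ∀ {c} (0<c : 0ℚ < c) → δ ≤ c → δ * recip c 0<c ≤ 1ℚ
    δ*recip≤1 {c} 0<c δ≤c = ℚ.≤-trans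
      (ℚ.*-monoʳ-≤-nonNeg (recip c 0<c) {{nonNegative (ℚ.<⇒≤ (recip-pos 0<c))}} δ≤c)
      (ℚ.≤-reflexive (recip-inv 0<c))
    diff : a′ - b′ ≡ (b - a) * (a′ * b′)
    diff = begin-equality
      a′ - b′                          ≡⟨ cong₂ _-_ (sym (ℚ.*-identityʳ a′)) (sym (ℚ.*-identityʳ b′)) ⟩
      a′ * 1ℚ - b′ * 1ℚ                ≡⟨ cong₂ (λ u v → a′ * u - b′ * v) (sym (recip-inv 0<b)) (sym (recip-inv 0<a)) ⟩
      a′ * (b * b′) - b′ * (a * a′)    ≡⟨ solve 4 (λ a b x y → x :* (b :* y) :- y :* (a :* x) := (b :- a) :* (x :* y)) refl a b a′ b′ ⟩
      (b - a) * (a′ * b′)              ∎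

  ι : ℤ → ℚ
  ι k = k / 1

  toℚᵘ-/ : ∀ i n → toℚᵘ (i / suc n) ℚᵘ.≃ ℚᵘ.mkℚᵘ i n
  toℚᵘ-/ i n = ℚ.toℚᵘ-fromℚᵘ (ℚᵘ.mkℚᵘ i n)

  /-mono-≤ : ∀ i m j n → i ℤ.* + suc n ℤ.≤ j ℤ.* + suc m → i / suc m ≤ j / suc n
  /-mono-≤ i m j n h = ℚ.toℚᵘ-cancel-≤
    (ℚᵘ.≤-respˡ-≃ (ℚᵘ.≃-sym (toℚᵘ-/ i m))
      (ℚᵘ.≤-respʳ-≃ (ℚᵘ.≃-sym (toℚᵘ-/ j n)) (ℚᵘ.*≤* h)))

  ι-+ : ∀ i j → ι (i ℤ.+ j) ≡ ι i + ι j
  ι-+ i j = ℚ.toℚᵘ-injective (ℚᵘ.≃-trans (toℚᵘ-/ (i ℤ.+ j) 0) (ℚᵘ.≃-sym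
    (ℚᵘ.≃-trans (ℚ.toℚᵘ-homo-+ (ι i) (ι j))
    (ℚᵘ.≃-trans (ℚᵘ.+-cong (toℚᵘ-/ i 0) (toℚᵘ-/ j 0))
      (ℚᵘ.*≡* (cong (ℤ._* + 1) (cong₂ ℤ._+_ (ℤ.*-identityʳ i) (ℤ.*-identityʳ j))))))))

  ι-neg : ∀ i → ι (ℤ.- i) ≡ - ι i
  ι-neg i = ℚ.toℚᵘ-injective (ℚᵘ.≃-trans (toℚᵘ-/ (ℤ.- i) 0) (ℚᵘ.≃-sym
    (ℚᵘ.≃-trans (ℚ.toℚᵘ-homo‿- (ι i)) (ℚᵘ.-‿cong (toℚᵘ-/ i 0)))))

  ι-mono-≤ : ∀ {i j} → i ℤ.≤ j → ι i ≤ ι j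
  ι-mono-≤ {i} {j} h = /-mono-≤ i 0 j 0 (ℤ.*-monoʳ-≤-nonNeg (+ 1) h)

  floor-≤ : ∀ p → ι (floor p) ≤ p
  floor-≤ p@record{} = ℚ.toℚᵘ-cancel-≤ (ℚᵘ.≤-respˡ-≃ (ℚᵘ.≃-sym (toℚᵘ-/ (floor p) 0))
    (ℚᵘ.*≤* (ℤ.≤-trans (ℤ.[n/d]*d≤n (↥ p) (↧ p)) (ℤ.≤-reflexive (sym (ℤ.*-identityʳ (↥ p)))))))

  <-floor+1 : ∀ p → p < ι (floor p) + 1ℚ
  <-floor+1 p@record{} = subst (p <_) (trans (cong ι (ℤ.+-comm (+ 1) (floor p))) (ι-+ (floor p) (+ 1)))
    (ℚ.toℚᵘ-cancel-< (ℚᵘ.<-respʳ-≃ (ℚᵘ.≃-sym (toℚᵘ-/ (ℤ.suc (floor p)) 0)) (ℚᵘ.*<* lem)))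
    where
    lem : ↥ p ℤ.* + 1 ℤ.< ℤ.suc (floor p) ℤ.* ↧ p
    lem = subst₂ ℤ._<_ (sym (ℤ.*-identityʳ (↥ p)))
      (cong (λ u → ℤ.suc u ℤ.* ↧ p) (sym (ℤ.div-pos-is-/ℕ (↥ p) (↧ₙ p))))
      (ℤ.n<s[n/ℕd]*d (↥ p) (↧ₙ p))

  ∣-∣-≤ : ∀ a {b} → a ≤ b → - a ≤ b → ∣ a ∣ ≤ b
  ∣-∣-≤ a {b} h k = [ (λ e → subst (_≤ b) (sym e) h) , (λ e → subst (_≤ b) (sym e) k) ]′
                    (ℚ.∣p∣≡p∨∣p∣≡-p a)

  ∣p-round∣≤½ : ∀ p → ∣ p - ι (round p) ∣ ≤ ½
  ∣p-round∣≤½ p with p ≤ᵇ 0ℚ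
  ... | false = ∣-∣-≤ (p - f)
    (subst₂ _≤_ (solve 2 (λ p f → (p :+ con ½) :+ (:- f :- con ½) := p :- f) refl p f)
                (solve 1 (λ f → (f :+ con 1ℚ) :+ (:- f :- con ½) := con ½) refl f)
                (ℚ.+-monoˡ-≤ (- f - ½) (ℚ.<⇒≤ (<-floor+1 (p + ½)))))
    (subst₂ _≤_ (solve 2 (λ p f → f :+ (:- p) := :- (p :- f)) refl p f)
                (solve 1 (λ p → (p :+ con ½) :+ (:- p) := con ½) refl p)
                (ℚ.+-monoˡ-≤ (- p) (floor-≤ (p + ½))))
    where f = ι (floor (p + ½))
  ... | true = subst (λ u → ∣ p - u ∣ ≤ ½) (sym c≡) (∣-∣-≤ (p - - f)
    (subst₂ _≤_ (solve 2 (λ p f → f :+ p := p :- (:- f)) refl p f)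
                (solve 1 (λ p → (:- (p :- con ½)) :+ p := con ½) refl p)
                (ℚ.+-monoˡ-≤ p (floor-≤ (- (p - ½)))))
    (subst₂ _≤_ (solve 2 (λ p f → (:- (p :- con ½)) :+ (:- f :- con ½) := :- (p :- (:- f))) refl p f)
                (solve 1 (λ f → (f :+ con 1ℚ) :+ (:- f :- con ½) := con ½) refl f)
                (ℚ.+-monoˡ-≤ (- f - ½) (ℚ.<⇒≤ (<-floor+1 (- (p - ½)))))))
    where
    f = ι (floor (- (p - ½)))
    c≡ : ι (ceiling (p - ½)) ≡ - f
    c≡ with p - ½
    ... | q@record{} = ι-neg (floor (- q))

  1≤∣ι∣ : ∀ k → k ≢ 0ℤ → 1ℚ ≤ ∣ ι k ∣
  1≤∣ι∣ (+ zero)    k≢0 = contradiction refl k≢0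
  1≤∣ι∣ (+ suc n)   k≢0 = subst (1ℚ ≤_) (sym (ℚ.0≤p⇒∣p∣≡p (ι-mono-≤ {0ℤ} {+ suc n} (ℤ.+≤+ ℕ.z≤n))))
                            (ι-mono-≤ {+ 1} {+ suc n} (ℤ.+≤+ (ℕ.s≤s ℕ.z≤n)))
  1≤∣ι∣ ℤ.-[1+ n ] k≢0 = subst (1ℚ ≤_)
    (sym (trans (cong ∣_∣ (ι-neg (+ suc n))) (ℚ.∣-p∣≡∣p∣ (ι (+ suc n)))))
    (1≤∣ι∣ (+ suc n) λ ())

  round-nearest : ∀ q k → ∣ q - ι (round q) ∣ ≤ ∣ q - ι k ∣
  round-nearest q k with k ℤ.≟ round q
  ... | yes k≡r = ℚ.≤-reflexive (cong (λ r → ∣ q - ι r ∣) (sym k≡r))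
  ... | no  k≢r = ℚ.≤-trans (∣p-round∣≤½ q) (subst₂ _≤_
      (solve 1 (λ z → con 1ℚ :- con ½ := con ½) refl 0ℚ)
      (solve 1 (λ d → (d :+ con ½) :- con ½ := d) refl ∣ q - ι k ∣)
      (ℚ.+-monoˡ-≤ (- ½) far))
    where
    open ℚ.≤-Reasoning
    r : ℤ
    r = round q
    far : 1ℚ ≤ ∣ q - ι k ∣ + ½
    far = begin
      1ℚ                              ≤⟨ 1≤∣ι∣ (k ℤ.- r) (λ e → k≢r (ℤ.i-j≡0⇒i≡j k r e)) ⟩
      ∣ ι (k ℤ.- r) ∣                 ≡⟨ cong ∣_∣ (trans (ι-+ k (ℤ.- r)) (cong (λ u → ι k + u) (ι-neg r))) ⟩
      ∣ ι k - ι r ∣                   ≤⟨ ∣-∣-triangle (ι k) q (ι r) ⟩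
      ∣ ι k - q ∣ + ∣ q - ι r ∣       ≤⟨ ℚ.+-mono-≤ (ℚ.≤-reflexive (∣-∣-sym (ι k) q)) (∣p-round∣≤½ q) ⟩
      ∣ q - ι k ∣ + ½                 ∎

  distℚ : ℚ → ℚ
  distℚ q = ∣ q - ι (round q) ∣

  distℚ-Lipschitz : ∀ p q {ε} → ∣ p - q ∣ < ε → ∣ distℚ p - distℚ q ∣ < ε
  distℚ-Lipschitz p q {ε} h = <⇒near (distℚ p) (distℚ q) (half p q h) (half q p (subst (_< ε) (∣-∣-sym p q) h))
    where
    open ℚ.≤-Reasoning
    half : ∀ p q → ∣ p - q ∣ < ε → distℚ p < distℚ q + ε
    half p q h = begin-strict
      distℚ p                       ≤⟨ round-nearest p (round q) ⟩
      ∣ p - ι (round q) ∣           ≤⟨ ∣-∣-triangle p q (ι (round q)) ⟩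
      ∣ p - q ∣ + distℚ q           <⟨ ℚ.+-monoˡ-< (distℚ q) h ⟩
      ε + distℚ q                   ≡⟨ ℚ.+-comm ε (distℚ q) ⟩
      distℚ q + ε                   ∎

  distℚ-periodic : ∀ q k → distℚ (q + ι k) ≡ distℚ q
  distℚ-periodic q k = ℚ.≤-antisym
    (subst (distℚ (q + ι k) ≤_) (cong ∣_∣ eq₁) (round-nearest (q + ι k) (round q ℤ.+ k)))
    (subst (distℚ q ≤_) (cong ∣_∣ eq₂) (round-nearest q (round (q + ι k) ℤ.- k)))
    where
    eq₁ : (q + ι k) - ι (round q ℤ.+ k) ≡ q - ι (round q)
    eq₁ = trans (cong (λ u → (q + ι k) - u) (ι-+ (round q) k))
      (solve 3 (λ q k r → (q :+ k) :- (r :+ k) := q :- r) refl q (ι k) (ι (round q)))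
    eq₂ : q - ι (round (q + ι k) ℤ.- k) ≡ (q + ι k) - ι (round (q + ι k))
    eq₂ = trans (cong (λ u → q - u) (trans (ι-+ r (ℤ.- k)) (cong (λ u → ι r + u) (ι-neg k))))
      (solve 3 (λ q k r → q :- (r :- k) := (q :+ k) :- r) refl q (ι k) (ι r))
      where r = round (q + ι k)

  ⊓-near : ∀ a a′ b b′ {ε} → ∣ a - a′ ∣ < ε → ∣ b - b′ ∣ < ε → ∣ (a ⊓ b) - (a′ ⊓ b′) ∣ < ε
  ⊓-near a a′ b b′ {ε} h k = <⇒near (a ⊓ b) (a′ ⊓ b′)
    (half a a′ b b′ (near⇒< a a′ h) (near⇒< b b′ k)) (half a′ a b′ b (near⇒> a a′ h) (near⇒> b b′ k))
    where
    half : ∀ a a′ b b′ → a < a′ + ε → b < b′ + ε → a ⊓ b < (a′ ⊓ b′) + ε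
    half a a′ b b′ h k with ℚ.⊓-sel a′ b′
    ... | inj₁ e = subst (λ u → a ⊓ b < u + ε) (sym e) (ℚ.≤-<-trans (ℚ.p⊓q≤p a b) h)
    ... | inj₂ e = subst (λ u → a ⊓ b < u + ε) (sym e) (ℚ.≤-<-trans (ℚ.p⊓q≤q a b) k)

  ⊔-near : ∀ a b {ε} c → 0ℚ < ε → ∣ a - b ∣ < ε → ∣ (c ⊔ a) - (c ⊔ b) ∣ < ε
  ⊔-near a b {ε} c 0<ε h =
    <⇒near (c ⊔ a) (c ⊔ b) (half a b (near⇒< a b h)) (half b a (near⇒> a b h))
    where
    half : ∀ a b → a < b + ε → c ⊔ a < (c ⊔ b) + ε
    half a b h with ℚ.⊔-sel c a
    ... | inj₁ e = subst (_< (c ⊔ b) + ε) (trans (ℚ.+-identityʳ c) (sym e))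
                     (ℚ.+-mono-≤-< (ℚ.p≤p⊔q c b) 0<ε)
    ... | inj₂ e = subst (_< (c ⊔ b) + ε) (sym e) (ℚ.<-≤-trans h (ℚ.+-monoˡ-≤ ε (ℚ.p≤q⊔p c b)))

  *-near : ∀ a b c d {B C η ε} → B * η + C * η ≡ ε → ∣ a ∣ < B → ∣ d ∣ < C →
           ∣ a - b ∣ < η → ∣ c - d ∣ < η → ∣ a * c - b * d ∣ < ε
  *-near a b c d {B} {C} {η} {ε} eq a<B d<C ab cd = begin-strict
    ∣ a * c - b * d ∣                      ≤⟨ ∣-∣-triangle (a * c) (a * d) (b * d) ⟩
    ∣ a * c - a * d ∣ + ∣ a * d - b * d ∣  ≡⟨ cong₂ _+_ e₁ e₂ ⟩
    ∣ a ∣ * ∣ c - d ∣ + ∣ d ∣ * ∣ a - b ∣  <⟨ ℚ.+-mono-< (step a (c - d) a<B cd) (step d (a - b) d<C ab) ⟩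
    B * η + C * η                          ≡⟨ eq ⟩
    ε                                      ∎
    where
    open ℚ.≤-Reasoning
    0<η : 0ℚ < η
    0<η = ℚ.≤-<-trans (ℚ.0≤∣p∣ (a - b)) ab
    e₁ : ∣ a * c - a * d ∣ ≡ ∣ a ∣ * ∣ c - d ∣
    e₁ = trans (cong ∣_∣ (solve 3 (λ a c d → a :* c :- a :* d := a :* (c :- d)) refl a c d))
               (ℚ.∣p*q∣≡∣p∣*∣q∣ a (c - d))
    e₂ : ∣ a * d - b * d ∣ ≡ ∣ d ∣ * ∣ a - b ∣
    e₂ = trans (cong ∣_∣ (solve 3 (λ a b d → a :* d :- b :* d := d :* (a :- b)) refl a b d))
               (ℚ.∣p*q∣≡∣p∣*∣q∣ d (a - b))
    step : ∀ x y {X} → ∣ x ∣ < X → ∣ y ∣ < η → ∣ x ∣ * ∣ y ∣ < X * η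
    step x y {X} h k = ℚ.≤-<-trans
      (ℚ.*-monoˡ-≤-nonNeg ∣ x ∣ {{ℚ.∣-∣-nonNeg x}} (ℚ.<⇒≤ k))
      (ℚ.*-monoˡ-<-pos η {{positive 0<η}} h)

  shares : ∀ {B C ε} → 0ℚ < B → 0ℚ < C → 0ℚ < ε → ∃[ η ] 0ℚ < η × B * η + C * η ≡ ε
  shares {B} {C} {ε} 0<B 0<C 0<ε = ε * r , *-pos 0<ε (recip-pos 0<B+C) ,
    trans (solve 4 (λ B C ε r → B :* (ε :* r) :+ C :* (ε :* r) := ε :* ((B :+ C) :* r)) refl B C ε r)
      (trans (cong (ε *_) (recip-inv 0<B+C)) (ℚ.*-identityʳ ε))
    where
    0<B+C : 0ℚ < B + C
    0<B+C = ℚ.+-mono-< 0<B 0<C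
    r : ℚ
    r = recip (B + C) 0<B+C

Eventually : (ℕ → Set) → Set
Eventually P = ∃[ N ] ∀ n → N ℕ.≤ n → P n

IsCauchy : (ℕ → ℚ) → Set
IsCauchy f = ∀ ε → 0ℚ ℚ.< ε → ∃[ N ] ∀ m n → N ℕ.≤ m → N ℕ.≤ n → ℚ.∣ f m ℚ.- f n ∣ ℚ.< ε

sum : ℕ → (ℕ → ℚ) → ℚ
sum zero    f = 0ℚ
sum (suc n) f = sum n f ℚ.+ f n

1/suc : ℕ → ℚ
1/suc k = + 1 ℚ./ suc k

segment : ℕ → ℕ → ℚ
segment a N = sum N λ i → 1/suc (a ℕ.+ i)

module _ where
  open import Data.Rational
  open +-*-Solver

  segment-+ : ∀ a N K → segment a (N ℕ.+ K) ≡ segment a N + segment (a ℕ.+ N) K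
  segment-+ a N zero    = trans (cong (segment a) (ℕ.+-identityʳ N)) (sym (ℚ.+-identityʳ _))
  segment-+ a N (suc K) = trans (cong (segment a) (ℕ.+-suc N K))
    (trans (cong₂ _+_ (segment-+ a N K) (cong 1/suc (sym (ℕ.+-assoc a N K))))
      (ℚ.+-assoc (segment a N) (segment (a ℕ.+ N) K) (1/suc (a ℕ.+ N ℕ.+ K))))

  segment-head : ∀ a N → segment a (suc N) ≡ 1/suc a + segment (suc a) N
  segment-head a N = trans (segment-+ a 1 N) (cong₂ _+_
    (trans (ℚ.+-identityˡ _) (cong 1/suc (ℕ.+-identityʳ a)))
    (cong (λ b → segment b N) (ℕ.+-comm a 1)))

  ι-suc-* : ∀ n c → ι (+ suc n) * c ≡ ι (+ n) * c + c
  ι-suc-* n c = trans (cong (_* c) (ι-+ (+ 1) (+ n)))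
    (solve 2 (λ a c → (con 1ℚ :+ a) :* c := a :* c :+ c) refl (ι (+ n)) c)

  sum-≤ : ∀ n {f c} → (∀ i → i ℕ.< n → f i ≤ c) → sum n f ≤ ι (+ n) * c
  sum-≤ zero    {c = c} h = ℚ.≤-reflexive (sym (ℚ.*-zeroˡ c))
  sum-≤ (suc n) {c = c} h = subst (_ ≤_) (sym (ι-suc-* n c))
    (ℚ.+-mono-≤ (sum-≤ n λ i i<n → h i (ℕ.m<n⇒m<1+n i<n)) (h n ℕ.≤-refl))

  sum-≥ : ∀ n {f c} → (∀ i → i ℕ.< n → c ≤ f i) → ι (+ n) * c ≤ sum n f
  sum-≥ zero    {c = c} h = ℚ.≤-reflexive (ℚ.*-zeroˡ c)
  sum-≥ (suc n) {c = c} h = subst (_≤ _) (sym (ι-suc-* n c))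
    (ℚ.+-mono-≤ (sum-≥ n λ i i<n → h i (ℕ.m<n⇒m<1+n i<n)) (h n ℕ.≤-refl))

  1/suc-anti : ∀ {a b} → a ℕ.≤ b → 1/suc b ≤ 1/suc a
  1/suc-anti {a} {b} h = /-mono-≤ (+ 1) b (+ 1) a
    (ℤ.*-monoˡ-≤-nonNeg (+ 1) (ℤ.+≤+ (ℕ.s≤s h)))

  1/suc-scale : ∀ p m → ι (+ suc p) * (+ 1 / (suc p ℕ.* suc m)) ≡ 1/suc m
  1/suc-scale p m = ℚ.toℚᵘ-injective (ℚᵘ.≃-trans (ℚ.toℚᵘ-homo-* (ι (+ suc p)) (+ 1 / (suc p ℕ.* suc m)))
    (ℚᵘ.≃-trans (ℚᵘ.*-cong (toℚᵘ-/ (+ suc p) 0) (toℚᵘ-/ (+ 1) (m ℕ.+ p ℕ.* suc m)))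
    (ℚᵘ.≃-trans (ℚᵘ.*≡* eq) (ℚᵘ.≃-sym (toℚᵘ-/ (+ 1) m)))))
    where
    eq : (+ suc p ℤ.* + 1) ℤ.* + suc m ≡ + 1 ℤ.* + (1 ℕ.* (suc p ℕ.* suc m))
    eq = trans (cong (ℤ._* + suc m) (ℤ.*-identityʳ (+ suc p)))
        (trans (sym (ℤ.pos-* (suc p) (suc m)))
        (trans (cong +_ (sym (ℕ.*-identityˡ (suc p ℕ.* suc m)))) (sym (ℤ.*-identityˡ _))))

  1/suc-pos : ∀ m → 0ℚ < 1/suc m
  1/suc-pos m = ℚ.positive⁻¹ (1/suc m) {{ℚ.normalize-pos 1 (suc m)}}

  1/suc-small : ∀ ε → 0ℚ < ε → ∃[ N ] 1/suc N < ε
  1/suc-small (mkℚ (+ zero)   d _) (*<* (ℤ.+<+ h)) = contradiction h (ℕ.≤⇒≯ ℕ.z≤n)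
  1/suc-small (mkℚ ℤ.-[1+ _ ] d _) (*<* ())
  1/suc-small ε@(mkℚ (+ suc a) d _) _ = suc d , ℚ.toℚᵘ-cancel-<
    (ℚᵘ.<-respˡ-≃ (ℚᵘ.≃-sym (toℚᵘ-/ (+ 1) (suc d))) (ℚᵘ.*<* lem))
    where
    lem : + 1 ℤ.* + suc d ℤ.< + suc a ℤ.* + suc (suc d)
    lem = subst₂ ℤ._<_ (sym (ℤ.*-identityˡ (+ suc d))) (ℤ.pos-* (suc a) (suc (suc d)))
      (ℤ.+<+ (ℕ.≤-trans (ℕ.n<1+n (suc d)) (ℕ.m≤m+n (suc (suc d)) (a ℕ.* suc (suc d)))))

-- With M = m + 1, the right Riemann sum of ∫₁ⁿ dt/t of mesh 1/M:
-- Σ_{i < (n-1)M} (1/M) · 1/(1 + (i+1)/M), whose i-th term is 1/(M+i+1).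
lnSum : ℕ → ℕ → ℚ
lnSum n m = sum (ℕ.pred n ℕ.* suc m) λ i → + 1 ℚ./ suc (suc m ℕ.+ i)

module _ (p : ℕ) where
  open import Data.Rational
  open +-*-Solver

  private
    S : ℕ → ℚ
    S = lnSum (suc p)

    T : ℕ → ℚ
    T m = segment (suc p ℕ.* suc m) (suc p)

  lnSum-step : ∀ m → 1/suc (suc m) + S (suc m) ≡ S m + T m
  lnSum-step m = trans (sym (segment-head (suc m) (p ℕ.* suc (suc m))))
    (trans (cong (segment (suc m)) eq) (segment-+ (suc m) (p ℕ.* suc m) (suc p)))
    where
    eq : suc (p ℕ.* suc (suc m)) ≡ p ℕ.* suc m ℕ.+ suc p
    eq = trans (cong suc (trans (ℕ.*-suc p (suc m)) (ℕ.+-comm p (p ℕ.* suc m))))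
               (sym (ℕ.+-suc (p ℕ.* suc m) p))

  T-≥ : ∀ m → 1/suc (suc m) ≤ T m
  T-≥ m = subst (_≤ T m) (1/suc-scale p (suc m)) (sum-≥ (suc p) λ i i<n →
    1/suc-anti (ℕ.s≤s⁻¹ (subst (suc (suc p ℕ.* suc m ℕ.+ i) ℕ.≤_)
      (trans (ℕ.+-comm (suc p ℕ.* suc m) (suc p)) (sym (ℕ.*-suc (suc p) (suc m))))
      (ℕ.+-monoʳ-< (suc p ℕ.* suc m) i<n))))

  T-≤ : ∀ m → T m ≤ 1/suc m
  T-≤ m = subst (T m ≤_) (1/suc-scale p m) (sum-≤ (suc p) λ i _ →
    1/suc-anti (ℕ.≤-trans (ℕ.n≤1+n _) (ℕ.m≤m+n (suc p ℕ.* suc m) i)))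

  lnSum-mono : ∀ {m n} → m ℕ.≤′ n → S m ≤ S n
  lnSum-mono ℕ.≤′-refl = ℚ.≤-refl
  lnSum-mono {m} (ℕ.≤′-step {n} h) = ℚ.≤-trans (lnSum-mono h)
    (subst₂ _≤_ (solve 2 (λ s v → (s :+ v) :- v := s) refl (S n) (1/suc (suc n)))
      (trans (cong (_- 1/suc (suc n)) (sym (lnSum-step n)))
        (solve 2 (λ s v → (v :+ s) :- v := s) refl (S (suc n)) (1/suc (suc n))))
      (ℚ.+-monoˡ-≤ (- 1/suc (suc n)) (ℚ.+-monoʳ-≤ (S n) (T-≥ n))))

  lnSum-upper : ∀ {m n} → m ℕ.≤′ n → S n + 1/suc n ≤ S m + 1/suc m
  lnSum-upper ℕ.≤′-refl = ℚ.≤-refl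
  lnSum-upper {m} (ℕ.≤′-step {n} h) = ℚ.≤-trans
    (subst (_≤ S n + 1/suc n) (trans (sym (lnSum-step n)) (ℚ.+-comm (1/suc (suc n)) (S (suc n))))
      (ℚ.+-monoʳ-≤ (S n) (T-≤ n)))
    (lnSum-upper h)

  lnSum-cauchy : IsCauchy S
  lnSum-cauchy ε 0<ε with 1/suc-small ε 0<ε
  ... | N , 1/sN<ε = N , λ m n h k →
    [ (λ m≤n → <⇒near (S m) (S n) (up m≤n) (down h m≤n)) , (λ n≤m → <⇒near (S m) (S n) (down k n≤m) (up n≤m)) ]′ (ℕ.≤-total m n)
    where
    up : ∀ {m n} → m ℕ.≤ n → S m < S n + ε
    up {m} m≤n = subst (_< _) (ℚ.+-identityʳ (S m)) (ℚ.+-mono-≤-< (lnSum-mono (ℕ.≤⇒≤′ m≤n)) 0<ε)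
    down : ∀ {m n} → N ℕ.≤ m → m ℕ.≤ n → S n < S m + ε
    down {m} {n} N≤m m≤n = begin-strict
      S n          ≡⟨ ℚ.+-identityʳ (S n) ⟨
      S n + 0ℚ     <⟨ ℚ.+-monoʳ-< (S n) (1/suc-pos n) ⟩
      S n + 1/suc n    ≤⟨ lnSum-upper (ℕ.≤⇒≤′ m≤n) ⟩
      S m + 1/suc m    ≤⟨ ℚ.+-monoʳ-≤ (S m) (1/suc-anti N≤m) ⟩
      S m + 1/suc N    <⟨ ℚ.+-monoʳ-< (S m) 1/sN<ε ⟩
      S m + ε      ∎
      where open ℚ.≤-Reasoning

-- Reals are Cauchy sequences of rationals, identified by _≃_ when their
-- difference is a null sequence.
record ℝ : Set where
  constructor mkℝ
  field
    seq    : ℕ → ℚ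
    cauchy : IsCauchy seq
open ℝ public

infix 4 _≃_ _≤_

_≃_ : ℝ → ℝ → Set
x ≃ y = ∀ ε → 0ℚ ℚ.< ε → Eventually λ n → ℚ.∣ seq x n ℚ.- seq y n ∣ ℚ.< ε

_≤_ : ℝ → ℝ → Set
x ≤ y = ∀ ε → 0ℚ ℚ.< ε → Eventually λ n → seq x n ℚ.< seq y n ℚ.+ ε

Positive : ℝ → Set
Positive x = ∃[ δ ] 0ℚ ℚ.< δ × Eventually λ n → δ ℚ.≤ seq x n

infixl 7 _*_
infixl 6 _+_ _-_ _⊓_
infix  8 -_

fromℚ : ℚ → ℝ
seq    (fromℚ q) _ = q
cauchy (fromℚ q) ε 0<ε = 0 , λ _ _ _ _ → subst (λ u → ℚ.∣ u ∣ ℚ.< ε) (sym (ℚ.+-inverseʳ q)) 0<ε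

_+_ : ℝ → ℝ → ℝ
seq    (x + y) n = seq x n ℚ.+ seq y n
cauchy (x + y) ε 0<ε with cauchy x (½ ℚ.* ε) (half-pos 0<ε) | cauchy y (½ ℚ.* ε) (half-pos 0<ε)
... | M , p | N , q = M ℕ.⊔ N , λ m n h k → ℚ.≤-<-trans (split (seq x m) (seq y m) (seq x n) (seq y n))
    (half-sum ε (p m n (ℕ.m⊔n≤o⇒m≤o M N h) (ℕ.m⊔n≤o⇒m≤o M N k))
                (q m n (ℕ.m⊔n≤o⇒n≤o M N h) (ℕ.m⊔n≤o⇒n≤o M N k)))
  where
  open import Data.Rational using (∣_∣)
  split : ∀ a b c d → ∣ (a ℚ.+ b) ℚ.- (c ℚ.+ d) ∣ ℚ.≤ ∣ a ℚ.- c ∣ ℚ.+ ∣ b ℚ.- d ∣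
  split a b c d = subst (λ u → ∣ u ∣ ℚ.≤ ∣ a ℚ.- c ∣ ℚ.+ ∣ b ℚ.- d ∣)
    (solve 4 (λ a b c d → (a :- c) :+ (b :- d) := (a :+ b) :- (c :+ d)) refl a b c d)
    (ℚ.∣p+q∣≤∣p∣+∣q∣ (a ℚ.- c) (b ℚ.- d))
    where open +-*-Solver

-_ : ℝ → ℝ
seq    (- x) n = ℚ.- seq x n
cauchy (- x) ε 0<ε with cauchy x ε 0<ε
... | N , p = N , λ m n h k → subst (λ u → ℚ.∣ u ∣ ℚ.< ε) (eq (seq x m) (seq x n)) (p n m k h)
  where
  open +-*-Solver
  eq : ∀ a b → b ℚ.- a ≡ ℚ.- a ℚ.- ℚ.- b
  eq = solve 2 (λ a b → b :- a := :- a :- (:- b)) refl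

_-_ : ℝ → ℝ → ℝ
x - y = x + (- y)

bound : (x : ℝ) → ∃[ B ] 0ℚ ℚ.< B × Eventually λ n → ℚ.∣ seq x n ∣ ℚ.< B
bound x with cauchy x 1ℚ (ℚ.positive⁻¹ 1ℚ)
... | N , p = ℚ.∣ a ∣ ℚ.+ 1ℚ , ℚ.+-mono-≤-< (ℚ.0≤∣p∣ a) (ℚ.positive⁻¹ 1ℚ) , N , λ n h → begin-strict
    ℚ.∣ seq x n ∣                  ≡⟨ cong ℚ.∣_∣ (solve 2 (λ a b → b := a :+ (b :- a)) refl a (seq x n)) ⟩
    ℚ.∣ a ℚ.+ (seq x n ℚ.- a) ∣    ≤⟨ ℚ.∣p+q∣≤∣p∣+∣q∣ a (seq x n ℚ.- a) ⟩
    ℚ.∣ a ∣ ℚ.+ ℚ.∣ seq x n ℚ.- a ∣ <⟨ ℚ.+-monoʳ-< ℚ.∣ a ∣ (p n N h ℕ.≤-refl) ⟩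
    ℚ.∣ a ∣ ℚ.+ 1ℚ                 ∎
  where
  open ℚ.≤-Reasoning
  open +-*-Solver
  a = seq x N

_*_ : ℝ → ℝ → ℝ
seq    (x * y) n = seq x n ℚ.* seq y n
cauchy (x * y) ε 0<ε =
  let B , 0<B , K , xB = bound x
      C , 0<C , L , yC = bound y
      η , 0<η , eq     = shares 0<B 0<C 0<ε
      M , p            = cauchy x η 0<η
      N , q            = cauchy y η 0<η
  in (K ℕ.⊔ L) ℕ.⊔ (M ℕ.⊔ N) , λ m n h k →
    let hKL = ℕ.m⊔n≤o⇒m≤o (K ℕ.⊔ L) (M ℕ.⊔ N) h
        kKL = ℕ.m⊔n≤o⇒m≤o (K ℕ.⊔ L) (M ℕ.⊔ N) k
        hMN = ℕ.m⊔n≤o⇒n≤o (K ℕ.⊔ L) (M ℕ.⊔ N) h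
        kMN = ℕ.m⊔n≤o⇒n≤o (K ℕ.⊔ L) (M ℕ.⊔ N) k
    in *-near (seq x m) (seq x n) (seq y m) (seq y n) eq
         (xB m (ℕ.m⊔n≤o⇒m≤o K L hKL)) (yC n (ℕ.m⊔n≤o⇒n≤o K L kKL))
         (p m n (ℕ.m⊔n≤o⇒m≤o M N hMN) (ℕ.m⊔n≤o⇒m≤o M N kMN))
         (q m n (ℕ.m⊔n≤o⇒n≤o M N hMN) (ℕ.m⊔n≤o⇒n≤o M N kMN))

-- Since the terms of y are eventually ≥ δ, replacing them by their maximum
-- with δ makes every term invertible and changes only finitely many of them.
inverse : (y : ℝ) → Positive y → ℝ
seq    (inverse y (δ , 0<δ , _)) n = recip (δ ℚ.⊔ seq y n) (ℚ.<-≤-trans 0<δ (ℚ.p≤p⊔q δ (seq y n)))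
cauchy (inverse y (δ , 0<δ , _)) ε 0<ε with cauchy y (ε ℚ.* (δ ℚ.* δ)) (*-pos 0<ε (*-pos 0<δ 0<δ))
... | N , p = N , λ m n h k →
  recip-Lipschitz δ (δ ℚ.⊔ seq y m) (δ ℚ.⊔ seq y n) 0<δ (δ≤ m) (δ≤ n) (0< m) (0< n) 0<ε
    (⊔-near (seq y m) (seq y n) δ (*-pos 0<ε (*-pos 0<δ 0<δ)) (p m n h k))
  where
  δ≤ : ∀ n → δ ℚ.≤ δ ℚ.⊔ seq y n
  δ≤ n = ℚ.p≤p⊔q δ (seq y n)
  0< : ∀ n → 0ℚ ℚ.< δ ℚ.⊔ seq y n
  0< n = ℚ.<-≤-trans 0<δ (δ≤ n)

inverse-correct : (y : ℝ) (y>0 : Positive y) → y * inverse y y>0 ≃ fromℚ 1ℚ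
inverse-correct y (δ , 0<δ , N , δ≤y) ε 0<ε = N , λ n h →
  subst (λ p → ℚ.∣ p ∣ ℚ.< ε) (sym (zero-diff n h)) 0<ε
  where
  0<⊔ : ∀ n → 0ℚ ℚ.< δ ℚ.⊔ seq y n
  0<⊔ n = ℚ.<-≤-trans 0<δ (ℚ.p≤p⊔q δ (seq y n))
  zero-diff : ∀ n → N ℕ.≤ n → seq y n ℚ.* recip (δ ℚ.⊔ seq y n) (0<⊔ n) ℚ.- 1ℚ ≡ 0ℚ
  zero-diff n h = trans
    (cong (λ p → p ℚ.* recip (δ ℚ.⊔ seq y n) (0<⊔ n) ℚ.- 1ℚ) (sym (ℚ.p≤q⇒p⊔q≡q (δ≤y n h))))
    (trans (cong (ℚ._- 1ℚ) (recip-inv (0<⊔ n))) (ℚ.+-inverseʳ 1ℚ))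

_⊓_ : ℝ → ℝ → ℝ
seq    (x ⊓ y) n = seq x n ℚ.⊓ seq y n
cauchy (x ⊓ y) ε 0<ε with cauchy x ε 0<ε | cauchy y ε 0<ε
... | M , p | N , q = M ℕ.⊔ N , λ m n h k →
    ⊓-near (seq x m) (seq x n) (seq y m) (seq y n)
           (p m n (ℕ.m⊔n≤o⇒m≤o M N h) (ℕ.m⊔n≤o⇒m≤o M N k))
           (q m n (ℕ.m⊔n≤o⇒n≤o M N h) (ℕ.m⊔n≤o⇒n≤o M N k))

fromℤ : ℤ → ℝ
fromℤ k = fromℚ (ι k)

-- Distance to the nearest integer: the continuous extension to ℝ of q ↦ ∣ q - round q ∣.
distℤ : ℝ → ℝ
seq    (distℤ x) n = distℚ (seq x n)
cauchy (distℤ x) ε 0<ε with cauchy x ε 0<ε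
... | N , p = N , λ m n h k → distℚ-Lipschitz (seq x m) (seq x n) (p m n h k)

ev-map₂ : ∀ {P Q R : ℕ → Set} → (∀ n → P n → Q n → R n) →
          Eventually P → Eventually Q → Eventually R
ev-map₂ f (M , p) (N , q) =
  M ℕ.⊔ N , λ n h → f n (p n (ℕ.m⊔n≤o⇒m≤o M N h)) (q n (ℕ.m⊔n≤o⇒n≤o M N h))

infix 4 _≈_

_≈_ : ℝ → ℝ → Set
s ≈ t = ∃[ k ] s - t ≃ fromℤ k

module _ where
  open import Data.Rational using (∣_∣; _<_) renaming (_+_ to _⊕_; _-_ to _⊖_; -_ to ⊖_)
  open +-*-Solver

  ≈-refl : ∀ {s} → s ≈ s
  ≈-refl {s} = 0ℤ , λ ε 0<ε → 0 , λ n _ → subst (λ u → ∣ u ∣ < ε)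
    (solve 1 (λ a → con 0ℚ := (a :- a) :- con 0ℚ) refl (seq s n)) 0<ε

  ≈-sym : ∀ {s t} → s ≈ t → t ≈ s
  ≈-sym {s} {t} (k , p) = ℤ.- k , λ ε 0<ε → let N , q = p ε 0<ε in
    N , λ n h → subst (_< ε) (eq (seq s n) (seq t n)) (q n h)
    where
    eq : ∀ a b → ∣ (a ⊖ b) ⊖ ι k ∣ ≡ ∣ (b ⊖ a) ⊖ ι (ℤ.- k) ∣
    eq a b = trans (sym (ℚ.∣-p∣≡∣p∣ ((a ⊖ b) ⊖ ι k))) (cong ∣_∣ (trans
      (solve 3 (λ a b k → :- ((a :- b) :- k) := (b :- a) :- (:- k)) refl a b (ι k))
      (cong (λ u → (b ⊖ a) ⊖ u) (sym (ι-neg k)))))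

  ≈-trans : ∀ {s t u} → s ≈ t → t ≈ u → s ≈ u
  ≈-trans {s} {t} {u} (k , p) (l , q) = k ℤ.+ l , λ ε 0<ε →
    ev-map₂ (λ n h h′ → ℚ.≤-<-trans (split (seq s n) (seq t n) (seq u n)) (half-sum ε h h′))
      (p (½ ℚ.* ε) (half-pos 0<ε)) (q (½ ℚ.* ε) (half-pos 0<ε))
    where
    split : ∀ a b c → ∣ (a ⊖ c) ⊖ ι (k ℤ.+ l) ∣ ℚ.≤ ∣ (a ⊖ b) ⊖ ι k ∣ ⊕ ∣ (b ⊖ c) ⊖ ι l ∣
    split a b c = subst (λ v → ∣ v ∣ ℚ.≤ ∣ (a ⊖ b) ⊖ ι k ∣ ⊕ ∣ (b ⊖ c) ⊖ ι l ∣)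
      (trans (solve 5 (λ a b c k l → ((a :- b) :- k) :+ ((b :- c) :- l) := (a :- c) :- (k :+ l))
                      refl a b c (ι k) (ι l))
             (cong (λ v → (a ⊖ c) ⊖ v) (sym (ι-+ k l))))
      (ℚ.∣p+q∣≤∣p∣+∣q∣ ((a ⊖ b) ⊖ ι k) ((b ⊖ c) ⊖ ι l))

𝕋 : Setoid 0ℓ 0ℓ
𝕋 = record
  { Carrier       = ℝ
  ; _≈_           = _≈_
  ; isEquivalence = record
    { refl  = λ {s} → ≈-refl {s}
    ; sym   = λ {s} {t} → ≈-sym {s} {t}
    ; trans = λ {s} {t} {u} → ≈-trans {s} {t} {u}
    }
  }

Point : Set
Point = Setoid.Carrier 𝕋

ρ : Point → Point → ℝ
ρ s t = distℤ (s - t)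

ρ-cong : ∀ {s s′ t t′} → s ≈ s′ → t ≈ t′ → ρ s t ≃ ρ s′ t′
ρ-cong {s} {s′} {t} {t′} (k , p) (l , q) ε 0<ε =
  ev-map₂ (λ n h h′ → near (seq s n) (seq s′ n) (seq t n) (seq t′ n) h h′)
    (p (½ ℚ.* ε) (half-pos 0<ε)) (q (½ ℚ.* ε) (half-pos 0<ε))
  where
  open import Data.Rational using (∣_∣; _<_) renaming (_+_ to _⊕_; _-_ to _⊖_; -_ to ⊖_)
  open +-*-Solver
  near : ∀ a a′ b b′ → ∣ (a ⊖ a′) ⊖ ι k ∣ < ½ ℚ.* ε → ∣ (b ⊖ b′) ⊖ ι l ∣ < ½ ℚ.* ε →
         ∣ distℚ (a ⊖ b) ⊖ distℚ (a′ ⊖ b′) ∣ < ε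
  near a a′ b b′ h h′ = subst (λ u → ∣ distℚ (a ⊖ b) ⊖ u ∣ < ε) (distℚ-periodic (a′ ⊖ b′) (k ℤ.- l))
    (distℚ-Lipschitz (a ⊖ b) ((a′ ⊖ b′) ⊕ ι (k ℤ.- l)) (ℚ.≤-<-trans bnd (half-sum ε h h′)))
    where
    α β : ℚ
    α = (a ⊖ a′) ⊖ ι k
    β = (b ⊖ b′) ⊖ ι l
    bnd : ∣ (a ⊖ b) ⊖ ((a′ ⊖ b′) ⊕ ι (k ℤ.- l)) ∣ ℚ.≤ ∣ α ∣ ⊕ ∣ β ∣
    bnd = subst (λ v → ∣ v ∣ ℚ.≤ ∣ α ∣ ⊕ ∣ β ∣)
      (trans (solve 6 (λ a a′ b b′ k l → ((a :- a′) :- k) :- ((b :- b′) :- l)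
                         := (a :- b) :- ((a′ :- b′) :+ (k :- l))) refl a a′ b b′ (ι k) (ι l))
             (cong (λ v → (a ⊖ b) ⊖ ((a′ ⊖ b′) ⊕ v))
               (sym (trans (ι-+ k (ℤ.- l)) (cong (λ u → ι k ⊕ u) (ι-neg l))))))
      (ℚ.∣p-q∣≤∣p∣+∣q∣ α β)

min₁≤k≤ : (n : ℕ) → {{NonZero n}} → (ℕ → ℝ) → ℝ
min₁≤k≤ (suc zero)    a = a 1
min₁≤k≤ (suc (suc n)) a = min₁≤k≤ (suc n) a ⊓ a (suc (suc n))

IsMaximum : (Point → ℝ) → ℝ → Set
IsMaximum f M = (∃[ t ] f t ≃ M) × (∀ t → f t ≤ M)

-- The sequence is x 1, x 2, …; the value x 0 is not used.
IsD : (ℕ → Point) → (n : ℕ) → {{NonZero n}} → ℝ → Set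
IsD x n = IsMaximum λ t → min₁≤k≤ n λ k → ρ t (x k)

-- ln n = ∫₁ⁿ dt/t; only positive integer arguments occur in φ.
ln : (n : ℕ) → {{NonZero n}} → ℝ
seq    (ln n)       = lnSum n
cauchy (ln (suc p)) = lnSum-cauchy p

2ln2 : ℝ
2ln2 = fromℤ (+ 2) * ln 2

½≤lnSum2 : ∀ m → ½ ℚ.≤ lnSum 2 m
½≤lnSum2 m = subst (ℚ._≤ lnSum 2 m)
  (trans (cong (λ k → ι (+ k) ℚ.* (+ 1 ℚ./ (suc m ℕ.* 2))) (ℕ.*-identityˡ (suc m))) (1/suc-scale m 1))
  (sum-≥ (1 ℕ.* suc m) λ i i<M → 1/suc-anti (ℕ.s≤s⁻¹ (subst (suc (suc m ℕ.+ i) ℕ.≤_) (ℕ.*-comm 2 (suc m))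
    (ℕ.+-monoʳ-< (suc m) i<M))))

2ln2-positive : Positive 2ln2
2ln2-positive = 1ℚ , ℚ.positive⁻¹ 1ℚ , 0 , λ m _ → ℚ.*-monoˡ-≤-nonNeg (ι (+ 2)) (½≤lnSum2 m)

φ : (n : ℕ) → {{NonZero n}} → ℝ
φ n = (ln (suc n) - ln n) * inverse 2ln2 2ln2-positive

{-# OPTIONS --safe #-}
module Submission where

-- On replacing each real by its m-th rational approximation, the circle minus x_1, …, x_n is a union of
-- n disjoint gaps with total half-length ½. Delete from the list of gaps, one at a time, the one that
-- contains x_{n+1}, then the one that contains x_{n+2}, and so on (any gap if there is none). The gap
-- deleted when x_{n+r+1} is added contains none of x_1, …, x_{n+r}, so its half-length is at most D_{n+r},
-- whence D_n + … + D_{2n-1} ≥ ½. As φ_n + … + φ_{2n-1} telescopes to (ln 2n - ln n) / 2 ln 2 = ½,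
-- some k in [n, 2n) has D_k ≥ φ_k. That D_k exists follows because the maximum is attained at the centre
-- of a gap, hence at one of the finitely many points ½(x_i + x_j) and ½(x_i + x_j) + ½. Choosing the best
-- of these, and comparing D_k with φ_k, is done under a double negation, which Inf permits.

open import Defs using
  (ι; ι-+; ι-neg; ι-mono-≤; floor-≤; <-floor+1; distℚ; distℚ-periodic; round-nearest; ∣-∣-≤;
   sum; segment; segment-+; lnSum; lnSum-upper; ½≤lnSum2; 1/suc; 1/suc-pos; recip; recip-pos;
   recip-inv; seq; φ)
open import Data.Integer as ℤ using (ℤ; +_; -[1+_])
import Data.Integer.DivMod as ℤ
import Data.Integer.Properties as ℤ
open import Data.List using (List; []; _∷_; length; cartesianProduct; cartesianProductWith; upTo)
open import Data.List.Membership.Propositional using (_∈_)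
open import Data.List.Membership.Propositional.Properties using (∈-cartesianProductWith⁺; ∈-cartesianProduct⁺; ∈-upTo⁺)
open import Data.List.Relation.Binary.Permutation.Propositional using (_↭_; ↭⇒↭ₛ)
import Data.List.Relation.Binary.Permutation.Propositional as ↭
open import Data.List.Relation.Binary.Permutation.Propositional.Properties using (All-resp-↭; ↭-length)
import Data.List.Relation.Binary.Permutation.Setoid.Properties as ↭ₛ
open import Data.List.Relation.Unary.All as All using (All; []; _∷_)
open import Data.List.Relation.Unary.AllPairs as AllPairs using (AllPairs; []; _∷_)
open import Data.List.Relation.Unary.Any using (here; there)
open import Data.Nat as ℕ using (ℕ; zero; suc; NonZero; z≤n; s≤s)
open import Data.Nat.InfinitelyOften using (Inf)
import Data.Nat.Properties as ℕ
open import Data.Product using (Σ-syntax; ∃-syntax; ∃₂; _×_; _,_)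
open import Data.Rational as ℚ using (ℚ; 0ℚ; 1ℚ; ½)
import Data.Rational.Properties as ℚ
open import Data.Rational.Solver using (module +-*-Solver)
open import Data.Sum using (_⊎_; inj₁; inj₂; [_,_]′)
open import Relation.Binary.Core using (Rel)
open import Relation.Binary.Definitions using (Total; Transitive)
open import Relation.Binary.PropositionalEquality
  using (_≡_; refl; sym; trans; cong; cong₂; subst; subst₂; setoid; resp₂; module ≡-Reasoning)
open import Relation.Nullary using (¬_; yes; no; Dec; contradiction)

-- Rational inequalities and the distance to the nearest integer.

module _ where
  open import Data.Rational
  open +-*-Solver

  -- Adding `a - x` to both sides reduces a linear inequality to a known one, or to a sum of known
  -- ones, plus an identity for the ring solver.
  ≤-shift : ∀ {x y} a {b} → x ≤ y → y + (a - x) ≡ b → a ≤ b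
  ≤-shift {x} a h eq = subst₂ _≤_
    (solve 2 (λ x a → x :+ (a :- x) := a) refl x a) eq (ℚ.+-monoˡ-≤ (a - x) h)

  ½-mono : ∀ {x y} → x ≤ y → ½ * x ≤ ½ * y
  ½-mono = ℚ.*-monoˡ-≤-nonNeg ½

  distℚ-neg : ∀ p → distℚ (- p) ≡ distℚ p
  distℚ-neg p = ℚ.≤-antisym (half p)
    (subst (λ u → distℚ u ≤ distℚ (- p)) (solve 1 (λ p → :- (:- p) := p) refl p) (half (- p)))
    where
    half : ∀ p → distℚ (- p) ≤ distℚ p
    half p = subst (distℚ (- p) ≤_)
      (trans (cong (λ u → ∣ - p - u ∣) (ι-neg (round p)))
        (trans (cong ∣_∣ (solve 2 (λ p r → :- p :- (:- r) := :- (p :- r)) refl p (ι (round p))))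
          (ℚ.∣-p∣≡∣p∣ (p - ι (round p)))))
      (round-nearest (- p) (ℤ.- round p))

  distℚ-sym : ∀ a b → distℚ (a - b) ≡ distℚ (b - a)
  distℚ-sym a b = trans (cong distℚ (solve 2 (λ a b → a :- b := :- (b :- a)) refl a b)) (distℚ-neg (b - a))

  distℚ-+ : ∀ p q → distℚ (p + q) ≤ distℚ p + distℚ q
  distℚ-+ p q = begin
    distℚ (p + q)                                 ≤⟨ round-nearest (p + q) (round p ℤ.+ round q) ⟩
    ∣ (p + q) - ι (round p ℤ.+ round q) ∣         ≡⟨ cong (λ u → ∣ (p + q) - u ∣) (ι-+ (round p) (round q)) ⟩
    ∣ (p + q) - (ι (round p) + ι (round q)) ∣     ≡⟨ cong ∣_∣ (solve 4 (λ p q r s → (p :+ q) :- (r :+ s) := (p :- r) :+ (q :- s)) refl p q (ι (round p)) (ι (round q))) ⟩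
    ∣ (p - ι (round p)) + (q - ι (round q)) ∣     ≤⟨ ℚ.∣p+q∣≤∣p∣+∣q∣ (p - ι (round p)) (q - ι (round q)) ⟩
    distℚ p + distℚ q                             ∎
    where open ℚ.≤-Reasoning

  distℚ-triangle : ∀ a b c → distℚ (a - c) ≤ distℚ (a - b) + distℚ (b - c)
  distℚ-triangle a b c = subst (λ u → distℚ u ≤ distℚ (a - b) + distℚ (b - c))
    (solve 3 (λ a b c → (a :- b) :+ (b :- c) := a :- c) refl a b c) (distℚ-+ (a - b) (b - c))

  distℚ≤∣∣ : ∀ p → distℚ p ≤ ∣ p ∣
  distℚ≤∣∣ p = subst (distℚ p ≤_) (cong ∣_∣ (solve 1 (λ p → p :- con 0ℚ := p) refl p))
    (round-nearest p ℤ.0ℤ)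

  p≤∣p∣ : ∀ p → p ≤ ∣ p ∣
  p≤∣p∣ p with ℚ.≤-total 0ℚ p
  ... | inj₁ 0≤p = ℚ.≤-reflexive (sym (ℚ.0≤p⇒∣p∣≡p 0≤p))
  ... | inj₂ p≤0 = ℚ.≤-trans p≤0 (ℚ.0≤∣p∣ p)

  -p≤∣p∣ : ∀ p → - p ≤ ∣ p ∣
  -p≤∣p∣ p = subst (- p ≤_) (ℚ.∣-p∣≡∣p∣ p) (p≤∣p∣ (- p))

  -- If the nearest integer is at least 1, its distance from `v` is at least `1 - v`; if it is at
  -- most 0, that distance is at least `v`.
  between⇒≤distℚ : ∀ {a v} → a ≤ v → v ≤ 1ℚ - a → a ≤ distℚ v
  between⇒≤distℚ {a} {v} a≤v v≤1-a with round v
  ... | + suc n = ℚ.≤-trans (≤-shift a (ℚ.+-mono-≤ v≤1-a (ι-mono-≤ {+ 1} {+ suc n} (ℤ.+≤+ (s≤s z≤n))))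
      (solve 3 (λ a v k → ((con 1ℚ :- a) :+ k) :+ (a :- (v :+ con 1ℚ)) := :- (v :- k)) refl a v (ι (+ suc n))))
    (-p≤∣p∣ (v - ι (+ suc n)))
  ... | + zero = ℚ.≤-trans (≤-shift a a≤v (solve 2 (λ a v → v :+ (a :- a) := v :- con 0ℚ) refl a v))
    (p≤∣p∣ (v - 0ℚ))
  ... | -[1+ n ] = ℚ.≤-trans (≤-shift a (ℚ.+-mono-≤ a≤v (ι-mono-≤ {ℤ.0ℤ} {+ suc n} (ℤ.+≤+ z≤n)))
      (trans (solve 3 (λ a v k → (v :+ k) :+ (a :- (a :+ con 0ℚ)) := v :- (:- k)) refl a v (ι (+ suc n)))
        (cong (λ u → v - u) (sym (ι-neg (+ suc n))))))
    (p≤∣p∣ (v - ι -[1+ n ]))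

  -- Arcs of the circle.

  -- The open arc of 𝕋 of length 2 · half around centre, empty when half = 0ℚ.
  record Arc : Set where
    constructor arc
    field
      centre half : ℚ
  open Arc

  Avoids : ℚ → Arc → Set
  Avoids p g = half g ≤ distℚ (centre g - p)

  Disjoint : Rel Arc _
  Disjoint g g′ = half g + half g′ ≤ distℚ (centre g - centre g′)

  Disjoint-sym : ∀ {g g′} → Disjoint g g′ → Disjoint g′ g
  Disjoint-sym {g} {g′} = subst₂ _≤_ (ℚ.+-comm (half g) (half g′)) (distℚ-sym (centre g) (centre g′))

  -- By the triangle inequality through `p`: the distance between the centres is at least `h + h′`,
  -- and less than `h` of it is spent between `c` and `p`.
  disjoint⇒avoids : ∀ {p g g′} → Disjoint g g′ → ¬ Avoids p g → Avoids p g′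
  disjoint⇒avoids {p} {arc c h} {arc c′ h′} dis hit = ≤-shift h′
    (ℚ.+-mono-≤ (ℚ.≤-trans dis (distℚ-triangle c p c′)) (ℚ.<⇒≤ (ℚ.≰⇒> hit)))
    (trans (solve 4 (λ h h′ x y → ((x :+ y) :+ h) :+ (h′ :- ((h :+ h′) :+ x)) := y) refl
        h h′ (distℚ (c - p)) (distℚ (p - c′)))
      (distℚ-sym p c′))

  infix 4 _⊑_
  -- Containment expressed through centres and half-lengths, so that disjointness and avoidance pass
  -- to the smaller arc by the triangle inequality.
  _⊑_ : Rel Arc _
  g′ ⊑ g = half g′ + distℚ (centre g - centre g′) ≤ half g

  ⊑-Disjoint : ∀ {g g′ k} → g′ ⊑ g → Disjoint g k → Disjoint g′ k
  ⊑-Disjoint {arc c h} {arc c′ h′} {arc y x} sub dis = ≤-shift (h′ + x)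
    (ℚ.+-mono-≤ sub (ℚ.≤-trans dis (distℚ-triangle c c′ y)))
    (solve 5 (λ h h′ x e f → (h :+ (e :+ f)) :+ ((h′ :+ x) :- ((h′ :+ e) :+ (h :+ x))) := f) refl
      h h′ x (distℚ (c - c′)) (distℚ (c′ - y)))

  -- A point is an arc of half-length 0, for which `Disjoint` amounts to `Avoids`.
  ⊑-Avoids : ∀ {g g′ p} → g′ ⊑ g → Avoids p g → Avoids p g′
  ⊑-Avoids {g} {g′} {p} sub av = subst (_≤ distℚ (centre g′ - p)) (ℚ.+-identityʳ (half g′))
    (⊑-Disjoint {g} {g′} {arc p 0ℚ} sub (subst (_≤ distℚ (centre g - p)) (sym (ℚ.+-identityʳ (half g))) av))

  -- This is why every gap carries the bound ½: up to ½ an offset along the line is no longer than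
  -- the corresponding distance on the circle.
  ≤½⇒≤distℚ : ∀ {h} → h ≤ ½ → h ≤ distℚ h
  ≤½⇒≤distℚ {h} h≤½ = between⇒≤distℚ ℚ.≤-refl
    (≤-shift h (ℚ.+-mono-≤ h≤½ h≤½) (solve 1 (λ h → (con ½ :+ con ½) :+ (h :- (h :+ h)) := con 1ℚ :- h) refl h))

  ⊑-offset : ∀ g g′ {x} → 0ℚ ≤ x → distℚ (centre g - centre g′) ≡ distℚ x →
             half g′ + x ≡ half g → g′ ⊑ g
  ⊑-offset g g′ {x} 0≤x eq refl = ℚ.+-monoʳ-≤ (half g′)
    (subst₂ _≤_ (sym eq) (ℚ.0≤p⇒∣p∣≡p 0≤x) (distℚ≤∣∣ x))

  -- Cutting an arc at a point inside it.

  module Cut (c h d p : ℚ) (r : ℤ) (p-c≡ : p - c ≡ d + ι r) (h≤½ : h ≤ ½)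
           (d≤h : d ≤ h) (-d≤h : - d ≤ h) where

    -- Modulo 1 the point `p` is `c + d`, so the pieces of (c - h, c + h) are (c - h, c + d) and (c
    -- + d, c + h).
    leftArc rightArc : Arc
    leftArc  = arc (c + ½ * (d - h)) (½ * (h + d))
    rightArc = arc (c + ½ * (d + h)) (½ * (h - d))

    halves : ½ * (h + d) + ½ * (h - d) ≡ h
    halves = solve 2 (λ d h → con ½ :* (h :+ d) :+ con ½ :* (h :- d) := h) refl d h

    0≤½[h-d] : 0ℚ ≤ ½ * (h - d)
    0≤½[h-d] = ½-mono (≤-shift 0ℚ d≤h (solve 2 (λ d h → h :+ (con 0ℚ :- d) := h :- d) refl d h))

    0≤½[h+d] : 0ℚ ≤ ½ * (h + d)
    0≤½[h+d] = ½-mono (≤-shift 0ℚ -d≤h (solve 2 (λ d h → h :+ (con 0ℚ :- (:- d)) := h :+ d) refl d h))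

    leftArc-half≤½ : ½ * (h + d) ≤ ½
    leftArc-half≤½ = ℚ.≤-trans (subst₂ _≤_ (ℚ.+-identityʳ _) halves (ℚ.+-monoʳ-≤ (½ * (h + d)) 0≤½[h-d])) h≤½

    rightArc-half≤½ : ½ * (h - d) ≤ ½
    rightArc-half≤½ = ℚ.≤-trans (subst₂ _≤_ (ℚ.+-identityˡ _) halves (ℚ.+-monoˡ-≤ (½ * (h - d)) 0≤½[h+d])) h≤½

    leftArc-⊑ : leftArc ⊑ arc c h
    leftArc-⊑ = ⊑-offset (arc c h) leftArc 0≤½[h-d]
      (cong distℚ (solve 3 (λ c d h → c :- (c :+ con ½ :* (d :- h)) := con ½ :* (h :- d)) refl c d h))
      halves

    rightArc-⊑ : rightArc ⊑ arc c h
    rightArc-⊑ = ⊑-offset (arc c h) rightArc 0≤½[h+d]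
      (trans (cong distℚ (solve 3 (λ c d h → c :- (c :+ con ½ :* (d :+ h)) := :- (con ½ :* (h :+ d))) refl c d h))
             (distℚ-neg (½ * (h + d))))
      (trans (ℚ.+-comm (½ * (h - d)) (½ * (h + d))) halves)

    offset-p : ∀ e → distℚ ((c + e) - p) ≡ distℚ (e - d)
    offset-p e = trans (sym (distℚ-periodic ((c + e) - p) r)) (cong distℚ (trans
      (solve 4 (λ c e p r → ((c :+ e) :- p) :+ r := (e :+ r) :- (p :- c)) refl c e p (ι r))
      (trans (cong (λ u → (e + ι r) - u) p-c≡)
        (solve 3 (λ d e r → (e :+ r) :- (d :+ r) := e :- d) refl d e (ι r)))))

    leftArc-avoids : Avoids p leftArc
    leftArc-avoids = subst (½ * (h + d) ≤_)
      (sym (trans (offset-p (½ * (d - h))) (trans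
        (cong distℚ (solve 2 (λ d h → con ½ :* (d :- h) :- d := :- (con ½ :* (h :+ d))) refl d h))
        (distℚ-neg (½ * (h + d))))))
      (≤½⇒≤distℚ leftArc-half≤½)

    rightArc-avoids : Avoids p rightArc
    rightArc-avoids = subst (½ * (h - d) ≤_)
      (sym (trans (offset-p (½ * (d + h)))
        (cong distℚ (solve 2 (λ d h → con ½ :* (d :+ h) :- d := con ½ :* (h :- d)) refl d h))))
      (≤½⇒≤distℚ rightArc-half≤½)

    leftArc-rightArc : Disjoint leftArc rightArc
    leftArc-rightArc = subst₂ _≤_ (sym halves)
      (trans (sym (distℚ-neg h)) (cong distℚ
        (solve 3 (λ c d h → :- h := (c :+ con ½ :* (d :- h)) :- (c :+ con ½ :* (d :+ h))) refl c d h)))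
      (≤½⇒≤distℚ h≤½)

  cut : ∀ p g → half g ≤ ½ → ¬ Avoids p g → ∃₂ λ g₁ g₂ →
        g₁ ⊑ g × g₂ ⊑ g × Avoids p g₁ × Avoids p g₂ × Disjoint g₁ g₂ ×
        half g₁ ≤ ½ × half g₂ ≤ ½ × half g₁ + half g₂ ≡ half g
  cut p (arc c h) h≤½ hit = go (p - c - ι r) eq ∣d∣≤h
    where
    r : ℤ
    r = round (p - c)
    eq : p - c ≡ (p - c - ι r) + ι r
    eq = solve 2 (λ a r → a := (a :- r) :+ r) refl (p - c) (ι r)
    ∣d∣≤h : ∣ p - c - ι r ∣ ≤ h
    ∣d∣≤h = subst (_≤ h) (distℚ-sym c p) (ℚ.<⇒≤ (ℚ.≰⇒> hit))
    go : ∀ d → p - c ≡ d + ι r → ∣ d ∣ ≤ h → ∃₂ λ g₁ g₂ →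
         g₁ ⊑ arc c h × g₂ ⊑ arc c h × Avoids p g₁ × Avoids p g₂ × Disjoint g₁ g₂ ×
         half g₁ ≤ ½ × half g₂ ≤ ½ × half g₁ + half g₂ ≡ h
    go d eq ∣d∣≤h = leftArc , rightArc , leftArc-⊑ , rightArc-⊑ , leftArc-avoids , rightArc-avoids ,
      leftArc-rightArc , leftArc-half≤½ , rightArc-half≤½ , halves
      where
      open Cut c h d p r eq h≤½ (ℚ.≤-trans (p≤∣p∣ d) ∣d∣≤h) (ℚ.≤-trans (-p≤∣p∣ d) ∣d∣≤h)

  -- Lists of disjoint arcs.

  sum-head : ∀ n f → sum (suc n) f ≡ f 0 + sum n (λ i → f (suc i))
  sum-head zero    f = ℚ.+-comm 0ℚ (f 0)
  sum-head (suc n) f = trans (cong (_+ f (suc n)) (sum-head n f)) (ℚ.+-assoc (f 0) _ (f (suc n)))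

  total : List Arc → ℚ
  total []      = 0ℚ
  total (g ∷ G) = half g + total G

  total-↭ : ∀ {G H} → G ↭ H → total G ≡ total H
  total-↭ ↭.refl         = refl
  total-↭ (↭.prep g p)   = cong (λ u → half g + u) (total-↭ p)
  total-↭ {H = _ ∷ _ ∷ H} (↭.swap g k p) = trans
    (cong (λ u → half g + (half k + u)) (total-↭ p))
    (solve 3 (λ a b c → a :+ (b :+ c) := b :+ (a :+ c)) refl (half g) (half k) (total H))
  total-↭ (↭.trans p q)  = trans (total-↭ p) (total-↭ q)

  Disjoint-↭ : ∀ {G H} → G ↭ H → AllPairs Disjoint G → AllPairs Disjoint H
  Disjoint-↭ p = ↭ₛ.AllPairs-resp-↭ (setoid Arc) (λ {g} {k} → Disjoint-sym {g} {k}) (resp₂ Disjoint) (↭⇒↭ₛ p)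

  -- Once an arc containing `p` is found, disjointness makes all later arcs avoid `p`. If none is
  -- found earlier, the last arc is moved to the front.
  isolate : ∀ p g G → AllPairs Disjoint (g ∷ G) →
            ∃₂ λ g′ G′ → g ∷ G ↭ g′ ∷ G′ × All (Avoids p) G′
  isolate p g []      _           = g , [] , ↭.refl , []
  isolate p g (k ∷ G) (dis ∷ rest) with half g ≤? distℚ (centre g - p)
  ... | no  hit = g , k ∷ G , ↭.refl , All.map (λ {k} d → disjoint⇒avoids {p} {g} {k} d hit) dis
  ... | yes av  =
    let g′ , G′ , perm , avs = isolate p k G rest
    in g′ , g ∷ G′ , ↭.trans (↭.prep g perm) (↭.swap g g′ ↭.refl) , av ∷ avs

  -- The gaps left by finitely many points.

  module _ (q : ℕ → ℚ) where

    Free : ℕ → Arc → Set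
    Free k g = ∀ j → j ℕ.< k → Avoids (q (suc j)) g

    Free-suc : ∀ {k g} → Free k g → Avoids (q (suc k)) g → Free (suc k) g
    Free-suc {k} {g} free av j j<1+k with ℕ.m≤n⇒m<n∨m≡n (ℕ.s≤s⁻¹ j<1+k)
    ... | inj₁ j<k  = free j j<k
    ... | inj₂ refl = av

    Free-⊑ : ∀ {k g g′} → g′ ⊑ g → Free k g → Free k g′
    Free-⊑ {k} {g} {g′} sub free j j<k = ⊑-Avoids {g} {g′} {q (suc j)} sub (free j j<k)

    -- The indices are independent because points are added while gaps are deleted: `k` counts the
    -- points avoided, `n` the gaps kept, and `s` is their total half-length.
    record Gaps (k n : ℕ) (s : ℚ) : Set where
      constructor gaps
      field
        arcs     : List Arc
        count    : length arcs ≡ n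
        sum-half : total arcs ≡ s
        ≤½       : All (λ g → half g ≤ ½) arcs
        free     : All (Free k) arcs
        disjoint : AllPairs Disjoint arcs

    add : ∀ {k n s} g (R : Gaps k n s) → half g ≤ ½ → Free k g → All (Disjoint g) (Gaps.arcs R) →
          Gaps k (suc n) (half g + s)
    add g (gaps G len tot ≤½ free dis) h≤½ fr d =
      gaps (g ∷ G) (cong suc len) (cong (λ u → half g + u) tot) (h≤½ ∷ ≤½) (fr ∷ free) (d ∷ dis)

    -- One step shared by two arguments: insertion puts `g` back, whole or in pieces, and the
    -- counting argument discards it. Only `rest` is known to avoid the next point.
    record Isolated (k n : ℕ) (s : ℚ) : Set where
      constructor isolated
      field
        {s′}     : ℚ
        g        : Arc
        rest     : Gaps (suc k) n s′
        sum-half : half g + s′ ≡ s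
        g≤½      : half g ≤ ½
        g-free   : Free k g
        disjoint : All (Disjoint g) (Gaps.arcs rest)

    isolate-gap : ∀ {k n s} → Gaps k (suc n) s → Isolated k n s
    isolate-gap {k} (gaps (g ∷ G) len tot ≤½ free dis) =
      let g′ , G′ , perm , avG′ = isolate (q (suc k)) g G dis
          ≤½′  = All-resp-↭ perm ≤½
          free′ = All-resp-↭ perm free
          dis′  = Disjoint-↭ perm dis
      in isolated g′
        (gaps G′ (ℕ.suc-injective (trans (sym (↭-length perm)) len)) refl (All.tail ≤½′)
          (All.zipWith (λ {g} (f , a) → Free-suc {k} {g} f a) (All.tail free′ , avG′)) (AllPairs.tail dis′))
        (trans (sym (total-↭ perm)) tot) (All.head ≤½′) (All.head free′) (AllPairs.head dis′)

    -- A point outside all gaps, such as a repeated term, contributes an empty gap, which keeps the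
    -- number of gaps equal to the number of points.
    insert-outside : ∀ {k n s} (R : Gaps k n s) → All (Avoids (q k)) (Gaps.arcs R) → Gaps k (suc n) s
    insert-outside {k} {n} R av = subst (Gaps k (suc n)) (ℚ.+-identityˡ _)
      (add (arc (q k) 0ℚ) R (ℚ.≤ᵇ⇒≤ _) (λ j _ → ℚ.0≤∣p∣ _) (All.map (λ {g} → point g) av))
      where
      point : ∀ g → Avoids (q k) g → Disjoint (arc (q k) 0ℚ) g
      point g = subst₂ _≤_ (sym (ℚ.+-identityˡ (half g))) (distℚ-sym (centre g) (q k))

    insert : ∀ {k n s} → Gaps k (suc n) s → Gaps (suc k) (suc (suc n)) s
    insert {k} {n} {s} G = go (isolate-gap G)
      where
      go : Isolated k n s → Gaps (suc k) (suc (suc n)) s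
      go (isolated {s′} g R h+s′≡s h≤½ fr d) = decide (half g ≤? distℚ (centre g - q (suc k)))
        where
        decide : Dec (Avoids (q (suc k)) g) → Gaps (suc k) (suc (suc n)) s
        -- No gap contains the new point, so `g` goes back whole.
        decide (yes av) = subst (Gaps (suc k) (suc (suc n))) h+s′≡s
          (insert-outside (add g R h≤½ (Free-suc {k} {g} fr av) d)
            (av ∷ All.map (λ f → f k ℕ.≤-refl) (Gaps.free R)))
        decide (no hit) =
          let g₁ , g₂ , s₁ , s₂ , a₁ , a₂ , d₁₂ , h₁ , h₂ , h≡ = cut (q (suc k)) g h≤½ hit
          in subst (Gaps (suc k) (suc (suc n)))
            (trans (sym (ℚ.+-assoc (half g₁) (half g₂) s′)) (trans (cong (λ u → u + s′) h≡) h+s′≡s))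
            (add g₁ (add g₂ R h₂ (Free-suc {k} {g₂} (Free-⊑ {k} {g} {g₂} s₂ fr) a₂)
                       (All.map (λ {g′} → ⊑-Disjoint {g} {g₂} {g′} s₂) d))
              h₁ (Free-suc {k} {g₁} (Free-⊑ {k} {g} {g₁} s₁ fr) a₁)
              (d₁₂ ∷ All.map (λ {g′} → ⊑-Disjoint {g} {g₁} {g′} s₁) d))

    partition : ∀ k → Gaps (suc k) (suc k) ½
    -- A single point leaves one gap, centred at the antipode.
    partition zero = gaps (arc (q 1 + ½) ½ ∷ []) refl (ℚ.+-identityʳ ½) (ℚ.≤-refl ∷ [])
      ((λ where zero _ → subst (½ ≤_) (cong distℚ (solve 1 (λ x → con ½ := (x :+ con ½) :- x) refl (q 1))) (≤½⇒≤distℚ ℚ.≤-refl)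
                (suc _) (s≤s ())) ∷ [])
      ([] ∷ [])
    partition (suc k) = insert (partition k)

    -- The isolated gap is charged to `b 0` and dropped. The others already avoid the next point, so
    -- the induction goes on with one point more and one gap fewer.
    total-≤-sum : ∀ n k {s} (b : ℕ → ℚ) → Gaps k n s →
                  (∀ r g → r ℕ.< n → Free (k ℕ.+ r) g → half g ≤ b r) → s ≤ sum n b
    total-≤-sum zero    k b (gaps [] _ refl _ _ _) _ = ℚ.≤-refl
    total-≤-sum (suc n) k {s} b G bnd = go (isolate-gap G)
      where
      go : Isolated k n s → s ≤ sum (suc n) b
      go (isolated g R h+s′≡s _ fr _) = subst₂ _≤_ h+s′≡s (sym (sum-head n b))
        (ℚ.+-mono-≤ (bnd 0 g (s≤s z≤n) (subst (λ k → Free k g) (sym (ℕ.+-identityʳ k)) fr))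
          (total-≤-sum n (suc k) (λ r → b (suc r)) R
            (λ r g r<n f → bnd (suc r) g (s≤s r<n) (subst (λ k → Free k g) (sym (ℕ.+-suc k r)) f))))

  -- Centres of gaps as midpoints.

  least-index : ∀ {ℓ} {A : Set} {_≲_ : Rel A ℓ} → Total _≲_ → Transitive _≲_ → (u : ℕ → A) →
                ∀ k → ∃[ i ] i ℕ.< suc k × (∀ j → j ℕ.< suc k → u i ≲ u j)
  least-index {_≲_ = _≲_} total trans u zero = 0 , s≤s z≤n , λ { zero _ → reflexive (u 0) ; (suc _) (s≤s ()) }
    where
    reflexive : ∀ a → a ≲ a
    reflexive a = [ (λ h → h) , (λ h → h) ]′ (total a a)
  least-index {_≲_ = _≲_} total trans u (suc k) with least-index total trans u k
  ... | i , i<k , least = pick (total (u i) (u (suc k)))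
    where
    extend : ∀ {a} → (∀ j → j ℕ.< suc k → a ≲ u j) → a ≲ u (suc k) → ∀ j → j ℕ.< suc (suc k) → a ≲ u j
    extend f g j j<2+k with ℕ.m≤n⇒m<n∨m≡n (ℕ.s≤s⁻¹ j<2+k)
    ... | inj₁ j<1+k = f j j<1+k
    ... | inj₂ refl  = g
    pick : u i ≲ u (suc k) ⊎ u (suc k) ≲ u i → _
    pick (inj₁ h) = i , ℕ.m<n⇒m<1+n i<k , extend least h
    pick (inj₂ h) = suc k , ℕ.≤-refl ,
      extend (λ j j<1+k → trans h (least j j<1+k)) ([ (λ h → h) , (λ h → h) ]′ (total (u (suc k)) (u (suc k))))

  -- Half a sum of two points of the circle is defined only modulo ½; `b` tells which of the two
  -- midpoints is meant.
  parity : ∀ z → ∃₂ λ (b : ℚ) w → (b ≡ 0ℚ ⊎ b ≡ ½) × ½ * ι z ≡ b + ι w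
  parity z = go (z ℤ.%ℕ 2) (ℤ.n%ℕd<d z 2) (ℤ.a≡a%ℕn+[a/ℕn]*n z 2)
    where
    w = z ℤ./ℕ 2
    double : ι (w ℤ.* + 2) ≡ ι w + ι w
    double = trans (cong ι (trans (ℤ.*-comm w (+ 2)) (trans (ℤ.*-distribʳ-+ w (+ 1) (+ 1))
      (cong₂ ℤ._+_ (ℤ.*-identityˡ w) (ℤ.*-identityˡ w))))) (ι-+ w w)
    go : ∀ r → r ℕ.< 2 → z ≡ + r ℤ.+ w ℤ.* + 2 → ∃₂ λ (b : ℚ) w → (b ≡ 0ℚ ⊎ b ≡ ½) × ½ * ι z ≡ b + ι w
    go 0 _ eq = 0ℚ , w , inj₁ refl ,
      trans (cong (λ u → ½ * u) (trans (cong ι eq) (trans (ι-+ (+ 0) (w ℤ.* + 2)) (cong (λ u → 0ℚ + u) double))))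
        (solve 1 (λ w → con ½ :* (con 0ℚ :+ (w :+ w)) := con 0ℚ :+ w) refl (ι w))
    go 1 _ eq = ½ , w , inj₂ refl ,
      trans (cong (λ u → ½ * u) (trans (cong ι eq) (trans (ι-+ (+ 1) (w ℤ.* + 2)) (cong (λ u → 1ℚ + u) double))))
        (solve 1 (λ w → con ½ :* (con 1ℚ :+ (w :+ w)) := con ½ :+ w) refl (ι w))
    go (suc (suc _)) (s≤s (s≤s ())) _

  midpoint : ℚ → ℚ → ℚ → ℚ
  midpoint b x y = ½ * (x + y) + b

  -- With α and 1 - β the least and the greatest of the fractional parts of q_j - t,
  -- the gap containing t is (t - β, t + α), and its centre is, modulo ½, a midpoint of two of the q_j.
  free-midpoint : ∀ q k {h t} → Free q (suc k) (arc t h) →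
                  ∃[ b ] ∃[ i ] ∃[ j ] (b ≡ 0ℚ ⊎ b ≡ ½) × i ℕ.< suc k × j ℕ.< suc k ×
                  Free q (suc k) (arc (midpoint b (q (suc i)) (q (suc j))) h)
  free-midpoint q k {h} {t} free
    with least-index ℚ.≤-total ℚ.≤-trans (λ l → q (suc l) - t - ι (floor (q (suc l) - t))) k
       | least-index {_≲_ = _≥_} (λ a b → ℚ.≤-total b a) (λ p q → ℚ.≤-trans q p) (λ l → q (suc l) - t - ι (floor (q (suc l) - t))) k
  -- The centre `t + ½ * (u i + u j - 1)` is half the sum of the two points plus half of this
  -- integer.
  ... | i , i<k , least | j , j<k , greatest = finish (parity (ℤ.- (m i ℤ.+ m j ℤ.+ + 1)))
    where
    m : ℕ → ℤ
    m l = floor (q (suc l) - t)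
    u : ℕ → ℚ
    u l = q (suc l) - t - ι (m l)
    h≤uᵢ : h ≤ u i
    h≤uᵢ = ℚ.≤-trans (free i i<k) (subst (_≤ u i) (sym (distℚ-sym t (q (suc i))))
      (ℚ.≤-trans (round-nearest (q (suc i) - t) (m i)) (ℚ.≤-reflexive (ℚ.0≤p⇒∣p∣≡p
        (≤-shift 0ℚ (floor-≤ (q (suc i) - t))
          (solve 2 (λ a b → a :+ (con 0ℚ :- b) := a :- b) refl (q (suc i) - t) (ι (m i))))))))
    h≤1-uⱼ : h ≤ 1ℚ - u j
    h≤1-uⱼ = ℚ.≤-trans (free j j<k) (subst (_≤ 1ℚ - u j) (sym (distℚ-sym t (q (suc j))))
      (ℚ.≤-trans (round-nearest (q (suc j) - t) (m j ℤ.+ + 1))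
        (∣-∣-≤ _ (≤-shift (v - ι (m j ℤ.+ + 1)) (ℚ.+-mono-≤ v≤ v≤)
            (trans (cong (λ z → ((ι (m j) + 1ℚ) + (ι (m j) + 1ℚ)) + ((v - z) - (v + v))) (ι-+ (m j) (+ 1)))
              (solve 2 (λ v n → ((n :+ con 1ℚ) :+ (n :+ con 1ℚ)) :+ ((v :- (n :+ con 1ℚ)) :- (v :+ v)) := con 1ℚ :- (v :- n)) refl v (ι (m j)))))
          (ℚ.≤-reflexive (trans (cong (λ z → - (v - z)) (ι-+ (m j) (+ 1)))
            (solve 2 (λ v n → :- (v :- (n :+ con 1ℚ)) := con 1ℚ :- (v :- n)) refl v (ι (m j))))))))
      where
      v : ℚ
      v = q (suc j) - t
      v≤ : v ≤ ι (m j) + 1ℚ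
      v≤ = ℚ.<⇒≤ (<-floor+1 v)
    -- The value q_l - c modulo 1, for c the centre of the gap.
    offset : ℚ → ℚ
    offset x = ½ + (x - ½ * (u i + u j))
    h≤offset : ∀ l → l ℕ.< suc k → h ≤ offset (u l)
    -- As `u l` is at least `u i`, the offset is at least the average of `u i` and `1 - u j`, both
    -- of which are at least `h`. The next bound is the mirror image, with `u j` in place of `u i`.
    h≤offset l l<k = ≤-shift h (ℚ.+-mono-≤ (½-mono (ℚ.+-mono-≤ h≤uᵢ h≤1-uⱼ)) (least l l<k))
      (solve 4 (λ h a b x → (con ½ :* (a :+ (con 1ℚ :- b)) :+ x) :+ (h :- (con ½ :* (h :+ h) :+ a)) := con ½ :+ (x :- con ½ :* (a :+ b))) refl h (u i) (u j) (u l))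
    offset≤1-h : ∀ l → l ℕ.< suc k → offset (u l) ≤ 1ℚ - h
    offset≤1-h l l<k = ≤-shift (offset (u l)) (ℚ.+-mono-≤ (½-mono (ℚ.+-mono-≤ h≤uᵢ h≤1-uⱼ)) (greatest l l<k))
      (solve 4 (λ h a b x → (con ½ :* (a :+ (con 1ℚ :- b)) :+ b) :+ ((con ½ :+ (x :- con ½ :* (a :+ b))) :- (con ½ :* (h :+ h) :+ x)) := con 1ℚ :- h) refl h (u i) (u j) (u l))
    finish : ∃₂ (λ (b : ℚ) w → (b ≡ 0ℚ ⊎ b ≡ ½) × ½ * ι (ℤ.- (m i ℤ.+ m j ℤ.+ + 1)) ≡ b + ι w) → _
    finish (b , w , b∈ , eq) = b , i , j , b∈ , i<k , j<k , λ l l<k →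
      subst (h ≤_) (sym (shifted l)) (between⇒≤distℚ (h≤offset l l<k) (offset≤1-h l l<k))
      where
      c : ℚ
      c = midpoint b (q (suc i)) (q (suc j))
      shifted : ∀ l → distℚ (c - q (suc l)) ≡ distℚ (offset (u l))
      shifted l = begin
        distℚ (c - q (suc l))                     ≡⟨ distℚ-sym c (q (suc l)) ⟩
        distℚ (q (suc l) - c)                     ≡⟨ cong distℚ (offset-from (q (suc i)) (q (suc j)) (q (suc l)) t (ι (m i)) (ι (m j)) (ι (m l)) b (ι w) eq′) ⟩
        distℚ (offset (u l) + (ι (m l) + ι w))    ≡⟨ cong (λ z → distℚ (offset (u l) + z)) (sym (ι-+ (m l) w)) ⟩
        distℚ (offset (u l) + ι (m l ℤ.+ w))      ≡⟨ distℚ-periodic (offset (u l)) (m l ℤ.+ w) ⟩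
        distℚ (offset (u l))                      ∎
        where
        open ≡-Reasoning
        eq′ : ½ * - (ι (m i) + ι (m j) + 1ℚ) ≡ b + ι w
        eq′ = trans (cong (λ z → ½ * z) (sym (trans (ι-neg (m i ℤ.+ m j ℤ.+ + 1))
          (cong -_ (trans (ι-+ (m i ℤ.+ m j) (+ 1)) (cong (λ z → z + 1ℚ) (ι-+ (m i) (m j)))))))) eq
        offset-from : ∀ x y z t m n l b w → ½ * - (m + n + 1ℚ) ≡ b + w →
          z - (½ * (x + y) + b) ≡ (½ + ((z - t - l) - ½ * ((x - t - m) + (y - t - n)))) + (l + w)
        offset-from x y z t m n l b w eq = trans
          (solve 5 (λ x y z b w → z :- (con ½ :* (x :+ y) :+ b) := ((z :- con ½ :* (x :+ y)) :- (b :+ w)) :+ w) refl x y z b w)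
          (trans (cong (λ e → ((z - ½ * (x + y)) - e) + w) (sym eq))
            (solve 8 (λ x y z t m n l w → ((z :- con ½ :* (x :+ y)) :- con ½ :* (:- (m :+ n :+ con 1ℚ))) :+ w :=
              (con ½ :+ ((z :- t :- l) :- con ½ :* ((x :- t :- m) :+ (y :- t :- n)))) :+ (l :+ w)) refl x y z t m n l w))

  -- The sum of φ from n to 2n - 1.

  telescope : ∀ n s (L : ℕ → ℚ) R →
              sum n (λ r → (L (suc (s ℕ.+ r)) - L (s ℕ.+ r)) * R) ≡ (L (s ℕ.+ n) - L s) * R
  telescope zero s L R = sym (trans (cong (λ z → (L z - L s) * R) (ℕ.+-identityʳ s))
    (solve 2 (λ a R → (a :- a) :* R := con 0ℚ) refl (L s) R))
  telescope (suc n) s L R = trans (cong (λ u → u + (L (suc (s ℕ.+ n)) - L (s ℕ.+ n)) * R) (telescope n s L R))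
    (trans (solve 4 (λ a b c R → (b :- a) :* R :+ (c :- b) :* R := (c :- a) :* R) refl (L s) (L (s ℕ.+ n)) (L (suc (s ℕ.+ n))) R)
      (cong (λ z → (L z - L s) * R) (sym (ℕ.+-suc s n))))

  -- Each of the n + 1 terms loses ε, and retaining a single ε is enough for a strict contradiction
  -- later.
  sum-≤-minus : ∀ n f ε → 0ℚ ≤ ε → sum (suc n) (λ r → f r - ε) ≤ sum (suc n) f - ε
  sum-≤-minus zero f ε _ = ℚ.≤-reflexive (sym (ℚ.+-assoc 0ℚ (f 0) (- ε)))
  sum-≤-minus (suc n) f ε 0≤ε = ≤-shift _ (ℚ.+-mono-≤ (sum-≤-minus n f ε 0≤ε) 0≤ε)
    (solve 4 (λ s t f ε → ((s :- ε) :+ ε) :+ ((t :+ (f :- ε)) :- (t :+ con 0ℚ)) := (s :+ f) :- ε) refl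
      (sum (suc n) f) (sum (suc n) (λ r → f r - ε)) (f (suc n)) ε)

  -- lnSum (2n) m - lnSum n m is the sum of 1/i over n(m + 1) < i ≤ 2n(m + 1), which is lnSum 2 at a finer mesh.
  lnSum-double : ∀ k m → lnSum (suc k ℕ.+ suc k) m - lnSum (suc k) m ≤ lnSum 2 m + 1/suc m
  lnSum-double k m = ≤-shift _
    (ℚ.+-mono-≤ (lnSum-upper 1 {m} {m′} (ℕ.≤⇒≤′ (ℕ.m≤m+n m (k ℕ.* suc m)))) (ℚ.<⇒≤ (1/suc-pos m′)))
    (trans (cong (λ u → ((lnSum 2 m + 1/suc m) + 1/suc m′) + (u - ((lnSum 2 m′ + 1/suc m′) + 0ℚ))) diff)
      (solve 3 (λ x a s → (x :+ a) :+ (s :- ((s :+ a) :+ con 0ℚ)) := x) refl (lnSum 2 m + 1/suc m) (1/suc m′) (lnSum 2 m′)))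
    where
    open ≡-Reasoning
    m′ : ℕ
    -- Chosen so that `suc m′` equals `suc k ℕ.* suc m`.
    m′ = m ℕ.+ k ℕ.* suc m
    diff : lnSum (suc k ℕ.+ suc k) m - lnSum (suc k) m ≡ lnSum 2 m′
    diff = begin
      segment (suc m) ((k ℕ.+ suc k) ℕ.* suc m) - A                ≡⟨ cong (λ N → segment (suc m) N - A) (ℕ.*-distribʳ-+ (suc m) k (suc k)) ⟩
      segment (suc m) (k ℕ.* suc m ℕ.+ suc m′) - A                 ≡⟨ cong (_- A) (segment-+ (suc m) (k ℕ.* suc m) (suc m′)) ⟩
      (A + segment (suc m′) (suc m′)) - A                          ≡⟨ solve 2 (λ a b → (a :+ b) :- a := b) refl A (segment (suc m′) (suc m′)) ⟩
      segment (suc m′) (suc m′)                                    ≡⟨ cong (segment (suc m′)) (sym (ℕ.*-identityˡ (suc m′))) ⟩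
      segment (suc m′) (1 ℕ.* suc m′)                              ∎
      where
      A : ℚ
      A = segment (suc m) (k ℕ.* suc m)

  -- After telescoping, numerator and denominator approximate ln 2 and 2 ln 2 with different meshes;
  -- this costs the error `1/suc m`.
  φ-sum : ∀ k m → sum (suc k) (λ r → seq (φ (suc k ℕ.+ r)) m) ≤ ½ + 1/suc m
  φ-sum k m = begin
    sum (suc k) (λ r → seq (φ (suc k ℕ.+ r)) m)              ≡⟨ telescope (suc k) (suc k) (λ n → lnSum n m) R ⟩
    (lnSum (suc k ℕ.+ suc k) m - lnSum (suc k) m) * R        ≤⟨ ℚ.*-monoʳ-≤-nonNeg R {{nonNegative (ℚ.<⇒≤ 0<R)}} (lnSum-double k m) ⟩
    (S + 1/suc m) * R                                        ≡⟨ solve 3 (λ s u R → (s :+ u) :* R := con ½ :* ((con (ι (+ 2)) :* s) :* R) :+ u :* R) refl S (1/suc m) R ⟩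
    -- Since `ι (+ 2) * S` is at least 1, it equals the maximum with 1 taken in `inverse`, and `R`
    -- is its exact reciprocal.
    ½ * (ι (+ 2) * S * R) + 1/suc m * R                      ≡⟨ cong (λ z → ½ * z + 1/suc m * R) (trans (cong (_* R) (sym (ℚ.p≤q⇒p⊔q≡q 1≤2S))) (recip-inv 0<)) ⟩
    ½ * 1ℚ + 1/suc m * R                                     ≤⟨ ℚ.+-monoʳ-≤ (½ * 1ℚ) (ℚ.*-monoˡ-≤-nonNeg (1/suc m) {{nonNegative (ℚ.<⇒≤ (1/suc-pos m))}} R≤1) ⟩
    ½ * 1ℚ + 1/suc m * 1ℚ                                    ≡⟨ cong₂ _+_ (ℚ.*-identityʳ ½) (ℚ.*-identityʳ (1/suc m)) ⟩
    ½ + 1/suc m                                              ∎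
    where
    open ℚ.≤-Reasoning
    S R : ℚ
    S = lnSum 2 m
    0< : 0ℚ < 1ℚ ⊔ (ι (+ 2) * S)
    0< = ℚ.<-≤-trans (ℚ.positive⁻¹ 1ℚ) (ℚ.p≤p⊔q 1ℚ (ι (+ 2) * S))
    R = recip (1ℚ ⊔ (ι (+ 2) * S)) 0<
    0<R : 0ℚ < R
    0<R = recip-pos 0<
    1≤2S : 1ℚ ≤ ι (+ 2) * S
    1≤2S = ℚ.*-monoˡ-≤-nonNeg (ι (+ 2)) (½≤lnSum2 m)
    R≤1 : R ≤ 1ℚ
    R≤1 = subst₂ _≤_ (ℚ.*-identityˡ R) (recip-inv 0<)
      (ℚ.*-monoʳ-≤-nonNeg R {{nonNegative (ℚ.<⇒≤ 0<R)}} (ℚ.p≤p⊔q 1ℚ (ι (+ 2) * S)))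

open import Defs

-- Comparing reals under double negation.

private
  module R = +-*-Solver

-- From `N` on, `x - y` stays within ε/4 of its `N`-th term, so comparing that one rational with
-- 3ε/4 decides between the bounds ε and ε/2.
gap-or-below : ∀ x y ε → 0ℚ ℚ.< ε →
               (Eventually λ n → seq x n ℚ.< seq y n ℚ.+ ε) ⊎
               (∃[ η ] 0ℚ ℚ.< η × Eventually λ n → seq y n ℚ.+ η ℚ.≤ seq x n)
gap-or-below x y ε 0<ε = decide (cauchy (x - y) θ 0<θ)
  where
  open R
  η θ : ℚ
  η = ½ ℚ.* ε
  θ = ½ ℚ.* η
  0<θ : 0ℚ ℚ.< θ
  0<θ = half-pos (half-pos 0<ε)
  z : ℕ → ℚ
  z = seq (x - y)
  up : ∀ a b → b ℚ.+ (a ℚ.- b) ≡ a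
  up = solve 2 (λ a b → b :+ (a :- b) := a) refl
  decide : (∃[ N ] ∀ m n → N ℕ.≤ m → N ℕ.≤ n → ℚ.∣ z m ℚ.- z n ∣ ℚ.< θ) → _
  decide (N , c) = case (z N ℚ.<? η ℚ.+ θ)
    where
    case : Dec (z N ℚ.< η ℚ.+ θ) → _
    case (yes zN<) = inj₁ (N , λ n N≤n → subst₂ ℚ._<_ (up (seq x n) (seq y n))
      (cong (seq y n ℚ.+_) (solve 1 (λ ε → (con ½ :* ε :+ con ½ :* (con ½ :* ε)) :+ con ½ :* (con ½ :* ε) := ε) refl ε))
      (ℚ.+-monoʳ-< (seq y n) (ℚ.<-trans (near⇒< (z n) (z N) (c n N N≤n ℕ.≤-refl)) (ℚ.+-monoˡ-< θ zN<))))
    case (no zN≮) = inj₂ (η , half-pos 0<ε , N , λ n N≤n → subst (seq y n ℚ.+ η ℚ.≤_) (up (seq x n) (seq y n))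
      (ℚ.+-monoʳ-≤ (seq y n) (≤-shift η (ℚ.≤-trans (ℚ.≮⇒≥ zN≮) (ℚ.<⇒≤ (near⇒> (z n) (z N) (c n N N≤n ℕ.≤-refl))))
        (solve 3 (λ z η θ → (z :+ θ) :+ (η :- (η :+ θ)) := z) refl (z n) η θ))))

≰⇒gap : ∀ {x y} → ¬ x ≤ y → ¬ ¬ (∃[ η ] 0ℚ ℚ.< η × Eventually λ n → seq y n ℚ.+ η ℚ.≤ seq x n)
≰⇒gap {x} {y} x≰y no-gap = x≰y λ ε 0<ε →
  [ (λ below → below) , (λ gap → contradiction gap no-gap) ]′ (gap-or-below x y ε 0<ε)

≤-refl : ∀ {x} → x ≤ x
≤-refl {x} ε 0<ε = 0 , λ n _ → subst (ℚ._< seq x n ℚ.+ ε) (ℚ.+-identityʳ (seq x n)) (ℚ.+-monoʳ-< (seq x n) 0<ε)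

≤-trans : ∀ {x y z} → x ≤ y → y ≤ z → x ≤ z
≤-trans {x} {y} {z} h k ε 0<ε = ev-map₂
  (λ n a b → ℚ.<-trans a (subst (seq y n ℚ.+ ½ ℚ.* ε ℚ.<_)
    (trans (ℚ.+-assoc (seq z n) (½ ℚ.* ε) (½ ℚ.* ε)) (cong (seq z n ℚ.+_) (half+half ε)))
    (ℚ.+-monoˡ-< (½ ℚ.* ε) b)))
  (h (½ ℚ.* ε) (half-pos 0<ε)) (k (½ ℚ.* ε) (half-pos 0<ε))

≤-total-¬¬ : ∀ x y → ¬ ¬ (x ≤ y ⊎ y ≤ x)
≤-total-¬¬ x y neither = ≰⇒gap {x} {y} (λ h → neither (inj₁ h)) λ (η , 0<η , N , gap) →
  neither (inj₂ λ ε 0<ε → N , λ n N≤n → ℚ.<-≤-trans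
    (subst (ℚ._< seq y n ℚ.+ η) (ℚ.+-identityʳ (seq y n)) (ℚ.+-monoʳ-< (seq y n) 0<η))
    (ℚ.≤-trans (gap n N≤n) (subst (ℚ._≤ seq x n ℚ.+ ε) (ℚ.+-identityʳ (seq x n)) (ℚ.+-monoʳ-≤ (seq x n) (ℚ.<⇒≤ 0<ε)))))

below-gap : ∀ h a b η → h ℚ.< a ℚ.+ ½ ℚ.* η → a ℚ.+ η ℚ.≤ b → h ℚ.≤ b ℚ.- ½ ℚ.* η
below-gap h a b η h<a+½η a+η≤b = ≤-shift h (ℚ.+-mono-≤ (ℚ.<⇒≤ h<a+½η) a+η≤b)
  (solve 4 (λ h a b η → ((a :+ con ½ :* η) :+ b) :+ (h :- (h :+ (a :+ η))) := b :- con ½ :* η) refl h a b η)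
  where open R

maximizer-¬¬ : ∀ {A : Set} (f : A → ℝ) → A → ∀ L → ¬ ¬ (∃[ c ] All (λ a → f a ≤ f c) L)
maximizer-¬¬ f c []      none = none (c , [])
maximizer-¬¬ f c (a ∷ L) none = maximizer-¬¬ f c L λ (b , max) → ≤-total-¬¬ (f a) (f b)
  [ (λ fa≤fb → none (b , fa≤fb ∷ max))
  , (λ fb≤fa → none (a , ≤-refl {f a} ∷ All.map (λ {a′} h → ≤-trans {f a′} {f b} {f a} h fb≤fa) max)) ]′

eventually-All : ∀ {A : Set} {P : A → ℕ → Set} {L} → All (λ a → Eventually (P a)) L →
                 Eventually λ n → All (λ a → P a n) L
eventually-All []       = 0 , λ _ _ → []
eventually-All (p ∷ ps) = ev-map₂ (λ _ → _∷_) p (eventually-All ps)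

-- Existence of the maximum.

min-≤ : ∀ k a m j → j ℕ.< suc k → seq (min₁≤k≤ (suc k) a) m ℚ.≤ seq (a (suc j)) m
min-≤ zero    a m zero    _        = ℚ.≤-refl
min-≤ zero    a m (suc j) (s≤s ())
min-≤ (suc k) a m j j<2+k with ℕ.m≤n⇒m<n∨m≡n (ℕ.s≤s⁻¹ j<2+k)
... | inj₁ j<1+k = ℚ.≤-trans (ℚ.p⊓q≤p (seq (min₁≤k≤ (suc k) a) m) _) (min-≤ k a m j j<1+k)
... | inj₂ refl  = ℚ.p⊓q≤q (seq (min₁≤k≤ (suc k) a) m) _

≤-min : ∀ k a m {h} → (∀ j → j ℕ.< suc k → h ℚ.≤ seq (a (suc j)) m) → h ℚ.≤ seq (min₁≤k≤ (suc k) a) m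
≤-min zero    a m h≤ = h≤ 0 (s≤s z≤n)
≤-min (suc k) a m h≤ = ℚ.⊓-glb (≤-min k a m λ j j<k → h≤ j (ℕ.m<n⇒m<1+n j<k)) (h≤ (suc k) ℕ.≤-refl)

module _ (x : ℕ → Point) where

  private
    q : ℕ → ℕ → ℚ
    q m j = seq (x j) m

    F : ℕ → Point → ℝ
    F k t = min₁≤k≤ (suc k) λ j → ρ t (x j)

  -- Its m-th term computes to the `midpoint` of the m-th terms.
  midpointᵣ : ℚ → ℕ × ℕ → Point
  midpointᵣ b (i , j) = fromℚ ½ * (x (suc i) + x (suc j)) + fromℚ b

  candidates : ℕ → List Point
  candidates k = cartesianProductWith midpointᵣ (0ℚ ∷ ½ ∷ []) (cartesianProduct (upTo (suc k)) (upTo (suc k)))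

  -- The candidate varies with `m` and with the arc, but the finite list it comes from does not; a
  -- maximizer over that list therefore works for every `m`.
  candidate-free : ∀ k m {t h} → Free (q m) (suc k) (arc t h) →
                   ∃[ c ] c ∈ candidates k × h ℚ.≤ seq (F k c) m
  candidate-free k m {t} {h} free = go (free-midpoint (q m) k {t = t} free)
    where
    go : (∃[ b ] ∃[ i ] ∃[ j ] (b ≡ 0ℚ ⊎ b ≡ ½) × i ℕ.< suc k × j ℕ.< suc k ×
            Free (q m) (suc k) (arc (midpoint b (q m (suc i)) (q m (suc j))) h)) →
         ∃[ c ] c ∈ candidates k × h ℚ.≤ seq (F k c) m
    go (b , i , j , b∈ , i<k , j<k , free′) =
      midpointᵣ b (i , j) ,
      ∈-cartesianProductWith⁺ midpointᵣ {xs = 0ℚ ∷ ½ ∷ []} {cartesianProduct (upTo (suc k)) (upTo (suc k))} ([ here , (λ e → there (here e)) ]′ b∈)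
        (∈-cartesianProduct⁺ {xs = upTo (suc k)} {upTo (suc k)} (∈-upTo⁺ i<k) (∈-upTo⁺ j<k)) ,
      ≤-min k (λ l → ρ (midpointᵣ b (i , j)) (x l)) m free′

  -- One index serves all rational arcs at once. This uniformity matters because the gaps to which
  -- it is applied change with `m`.
  Dominates : ℕ → Point → Set
  Dominates k c = ∀ ε → 0ℚ ℚ.< ε → Eventually λ m → ∀ t h →
                  Free (q m) (suc k) (arc t h) → h ℚ.< seq (F k c) m ℚ.+ ε

  dominates-¬¬ : ∀ k → ¬ ¬ (∃[ c ] Dominates k c)
  -- `x 0` is a default start of the search; the point found is at least as good as every candidate.
  dominates-¬¬ k none = maximizer-¬¬ (F k) (x 0) (candidates k) λ (c , max) →
    none (c , λ ε 0<ε →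
      let N , below = eventually-All (All.map (λ h → h ε 0<ε) max)
      in N , λ m N≤m t h free →
        let c′ , c′∈ , h≤ = candidate-free k m {t} {h} free
        in ℚ.≤-<-trans h≤ (All.lookup (below m N≤m) c′∈))

  dominates⇒IsD : ∀ k c → Dominates k c → IsD x (suc k) (F k c)
  dominates⇒IsD k c dom = (c , λ ε 0<ε → 0 , λ n _ → subst (λ u → ℚ.∣ u ∣ ℚ.< ε) (sym (ℚ.+-inverseʳ (seq (F k c) n))) 0<ε) ,
    λ t ε 0<ε → let N , p = dom ε 0<ε in N , λ m N≤m →
      -- The m-th term of `F k t` is the half-length of a free arc around `seq t m`.
      p m N≤m (seq t m) (seq (F k t) m) (λ j j<k → min-≤ k (λ j → ρ t (x j)) m j j<k)

  -- Contradiction with a total half-length of ½.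

  Below : ℕ → ℚ → ℕ → Set
  Below k ε m = ∀ g → Free (q m) (suc k) g → Arc.half g ℚ.≤ seq (φ (suc k)) m ℚ.- ε

  below-¬¬ : ∀ k → ¬ (∃[ D ] IsD x (suc k) D × φ (suc k) ≤ D) →
             ¬ ¬ (∃[ ε ] 0ℚ ℚ.< ε × Eventually (Below k ε))
  below-¬¬ k φ≰D none = dominates-¬¬ k λ (c , dom) →
    ≰⇒gap {φ (suc k)} {F k c} (λ φ≤ → φ≰D (F k c , dominates⇒IsD k c dom , φ≤)) λ (η , 0<η , gap) →
    -- Half of η absorbs the slack in `Dominates`; the other half remains as the margin.
    none (½ ℚ.* η , half-pos 0<η , ev-map₂ (λ m p gap g free →
      below-gap (Arc.half g) (seq (F k c) m) (seq (φ (suc k)) m) η (p (Arc.centre g) (Arc.half g) free) gap)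
      (dom (½ ℚ.* η) (half-pos 0<η)) gap)

  -- Finitely many double negations combine, and the smallest margin serves all stages.
  below-all-¬¬ : ∀ i → (∀ r → ¬ (∃[ D ] IsD x (suc (i ℕ.+ r)) D × φ (suc (i ℕ.+ r)) ≤ D)) → ∀ n →
                 ¬ ¬ (∃[ ε ] 0ℚ ℚ.< ε × Eventually λ m → ∀ r → r ℕ.< n → Below (i ℕ.+ r) ε m)
  below-all-¬¬ i φ≰D zero    none = none (1ℚ , ℚ.positive⁻¹ 1ℚ , 0 , λ _ _ _ ())
  below-all-¬¬ i φ≰D (suc n) none = below-all-¬¬ i φ≰D n λ (ε₁ , 0<ε₁ , ev₁) →
    below-¬¬ (i ℕ.+ n) (φ≰D n) λ (ε₂ , 0<ε₂ , ev₂) →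
    none (ε₁ ℚ.⊓ ε₂ , [ (λ e → subst (0ℚ ℚ.<_) (sym e) 0<ε₁) , (λ e → subst (0ℚ ℚ.<_) (sym e) 0<ε₂) ]′ (ℚ.⊓-sel ε₁ ε₂) ,
      ev-map₂ (λ m b₁ b₂ r r<1+n g free →
        [ (λ r<n → ℚ.≤-trans (b₁ r r<n g free) (weaken r m (ℚ.p⊓q≤p ε₁ ε₂)))
        , (λ { refl → ℚ.≤-trans (b₂ g free) (weaken r m (ℚ.p⊓q≤q ε₁ ε₂)) }) ]′ (ℕ.m≤n⇒m<n∨m≡n (ℕ.s≤s⁻¹ r<1+n)))
        ev₁ ev₂)
    where
    weaken : ∀ r m {δ ε} → δ ℚ.≤ ε → seq (φ (suc (i ℕ.+ r))) m ℚ.- ε ℚ.≤ seq (φ (suc (i ℕ.+ r))) m ℚ.- δ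
    weaken r m δ≤ε = ℚ.+-monoʳ-≤ (seq (φ (suc (i ℕ.+ r))) m) (ℚ.neg-antimono-≤ δ≤ε)

  φ≤D-¬¬ : ∀ i → ¬ (∀ r → ¬ (∃[ D ] IsD x (suc (i ℕ.+ r)) D × φ (suc (i ℕ.+ r)) ≤ D))
  -- With n = i + 1, the n stages `r` = 0, ..., i are exactly the indices from n to 2n - 1.
  φ≤D-¬¬ i φ≰D = below-all-¬¬ i φ≰D (suc i) λ (ε , 0<ε , N , below) →
    let M , 1/M<ε = 1/suc-small ε 0<ε
        -- Late enough for all the gap bounds to hold and for the mesh error to be less than ε.
        m = N ℕ.⊔ M
        φₘ = λ r → seq (φ (suc i ℕ.+ r)) m
    in ℚ.<-irrefl {½} refl (begin-strict
      ½                                    ≤⟨ total-≤-sum (q m) (suc i) (suc i) (λ r → φₘ r ℚ.- ε) (partition (q m) i)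
                                                (λ r g r<n → below m (ℕ.m≤m⊔n N M) r r<n g) ⟩
      sum (suc i) (λ r → φₘ r ℚ.- ε)       ≤⟨ sum-≤-minus i φₘ ε (ℚ.<⇒≤ 0<ε) ⟩
      sum (suc i) φₘ ℚ.- ε                 ≤⟨ ℚ.+-monoˡ-≤ (ℚ.- ε) (φ-sum i m) ⟩
      (½ ℚ.+ 1/suc m) ℚ.- ε                ≤⟨ ℚ.+-monoˡ-≤ (ℚ.- ε) (ℚ.+-monoʳ-≤ ½ (1/suc-anti (ℕ.m≤n⊔m N M))) ⟩
      (½ ℚ.+ 1/suc M) ℚ.- ε                <⟨ ℚ.+-monoˡ-< (ℚ.- ε) (ℚ.+-monoʳ-< ½ 1/M<ε) ⟩
      (½ ℚ.+ ε) ℚ.- ε                      ≡⟨ R.solve 2 (λ a ε → (a R.:+ ε) R.:- ε R.:= a) refl ½ ε ⟩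
      ½                                    ∎)
    where open ℚ.≤-Reasoning

theorem1 : (x : ℕ → Point) →
    Inf (λ n → Σ[ n≥1 ∈ NonZero n ] ∃[ D ] (IsD x n {{n≥1}} D × φ n {{n≥1}} ≤ D))
-- `Inf` denies that the property fails from some index on; `i` is such an alleged index, and every
-- `suc (i ℕ.+ r)` lies beyond it.
theorem1 x (i , none) = φ≤D-¬¬ x i λ r (D , isD , φ≤D) →
  none (suc (i ℕ.+ r)) (ℕ.≤-trans (ℕ.m≤m+n i r) (ℕ.n≤1+n (i ℕ.+ r))) (_ , D , isD , φ≤D)
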